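{- Let $p$ be a prime, let $h>0$ be an integer, let $q=p^h$, and let $i$ be a power of $p$. There is a polynomial $C_i$ in several variables with coefficients in $\mathbb{F}_p$ such that the following holds: whenever $F=\sum f_{k\ell}X^kY^\ell$ and $F'=\sum f'_{k\ell}X^kY^\ell$ are formal group laws of height $h$ over an integral domain $R$ of characteristic $p$ and $U=\sum_j u_j\tau^j$ is a homomorphism from $F$ to $F'$, then $$v'_1u_i^q-v_1^iu_i=C_i\bigl(u_j,f_{k\ell},f'_{k\ell}\;\big|\;j<i,\ k+\ell\le qi\bigr),$$ where $v_1,v'_1$ are the first nonzero coefficients of the power series $[p]_F$, $[p]_{F'}$ respectively.
   Context: A formal group law over $R$ is $F\in R[[X,Y]]$ with $F(X,0)=X$, $F(X,Y)=F(Y,X)$, $F(F(X,Y),Z)=F(X,F(Y,Z))$; a homomorphism $F\to F'$ is $U\in\tau R[[\tau]]$ with $U(F(X,Y))=F'(U(X),U(Y))$. $[p]_F$ is defined by $[1]=\tau$, $[n+1]=F([n]\tau,\tau)$. The height of a power series $U$ is the largest $h$ such that $U(\tau)=V(\tau^{p^h})$ for some power series $V$ ($\infty$ if $U=0$); the height of $F$ is the height of $[p]_F$. -}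

module Defs where

open import Level using (Level; Setω)
open import Data.Bool using (Bool; true; false; if_then_else_; _∧_)
open import Data.Nat as ℕ using (ℕ; zero; suc; _≤_; _<_; _∸_; _≡ᵇ_)
open import Data.Fin using (Fin)
import Data.Fin
open import Data.Vec using (Vec; []; _∷_; lookup)
open import Data.List using (List; []; _∷_; map; concatMap; upTo; foldr)
open import Data.Product using (Σ; _×_; _,_)
open import Data.Sum using (_⊎_)
open import Relation.Nullary using (¬_)
open import Algebra.Bundles using (CommutativeRing)

-- Polynomial expressions with coefficients in F_p.
-- Constants are natural numbers; evaluated in a ring of characteristic p
-- they only matter modulo p, so these are exactly polynomials over F_p
-- (subtraction is not needed since -1 = p - 1).

data Poly (V : Set) : Set where
  con : ℕ → Poly V
  var : V → Poly V
  _⊕_ : Poly V → Poly V → Poly V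
  _⊗_ : Poly V → Poly V → Poly V

-- Variables of C_i : u_j (j < i), f_{kl} and f'_{kl} (k + l ≤ N), N = q i.
data Var (i N : ℕ) : Set where
  u  : (j : ℕ) → j < i → Var i N
  f  : (k l : ℕ) → k ℕ.+ l ≤ N → Var i N
  f′ : (k l : ℕ) → k ℕ.+ l ≤ N → Var i N

-- Existential whose body lives in Setω (needed because the polynomial is
-- chosen before quantifying over rings of arbitrary universe levels).
record ∃ω (A : Set) (P : A → Setω) : Setω where
  constructor _,ω_
  field
    witness : A
    proof   : P witness

module Series {c ℓ : Level} (R : CommutativeRing c ℓ) where
  open CommutativeRing R

  natR : ℕ → Carrier
  natR zero    = 0#
  natR (suc n) = 1# + natR n

  _^ᴿ_ : Carrier → ℕ → Carrier
  x ^ᴿ zero  = 1#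
  x ^ᴿ suc n = x * (x ^ᴿ n)

  sumL : List Carrier → Carrier
  sumL = foldr _+_ 0#

  eval : {V : Set} → (V → Carrier) → Poly V → Carrier
  eval ρ (con n) = natR n
  eval ρ (var v) = ρ v
  eval ρ (a ⊕ b) = eval ρ a + eval ρ b
  eval ρ (a ⊗ b) = eval ρ a * eval ρ b

  IsIntegralDomain : Set (c Level.⊔ ℓ)
  IsIntegralDomain = (¬ (1# ≈ 0#)) × (∀ x y → x * y ≈ 0# → (x ≈ 0#) ⊎ (y ≈ 0#))

  -- p · 1 = 0 in R (for p prime and R a domain: characteristic exactly p)
  HasCharacteristic : ℕ → Set ℓ
  HasCharacteristic p = natR p ≈ 0#

  PS : ℕ → Set c
  PS n = Vec ℕ n → Carrier

  infix 4 _≋_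
  _≋_ : {n : ℕ} → PS n → PS n → Set ℓ
  A ≋ B = ∀ α → A α ≈ B α

  total : {n : ℕ} → Vec ℕ n → ℕ
  total []      = 0
  total (a ∷ α) = a ℕ.+ total α

  splits : {n : ℕ} → Vec ℕ n → List (Vec ℕ n × Vec ℕ n)
  splits []      = ([] , []) ∷ []
  splits (a ∷ α) =
    concatMap (λ k → map (λ { (β , γ) → (k ∷ β , (a ∸ k) ∷ γ) }) (splits α))
              (upTo (suc a))

  box : (m d : ℕ) → List (Vec ℕ m)
  box zero    d = [] ∷ []
  box (suc m) d = concatMap (λ k → map (k ∷_) (box m d)) (upTo (suc d))

  zeroₛ : {n : ℕ} → PS n
  zeroₛ _ = 0#

  oneₛ : {n : ℕ} → PS n
  oneₛ α = if total α ≡ᵇ 0 then 1# else 0#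

  X : {n : ℕ} → Fin n → PS n
  X i α = if (lookup α i ≡ᵇ 1) ∧ (total α ≡ᵇ 1) then 1# else 0#

  τ : PS 1
  τ = X Data.Fin.zero

  _*ₛ_ : {n : ℕ} → PS n → PS n → PS n
  (A *ₛ B) α = sumL (map (λ { (β , γ) → A β * B γ }) (splits α))

  _^ₛ_ : {n : ℕ} → PS n → ℕ → PS n
  A ^ₛ zero  = oneₛ
  A ^ₛ suc k = A *ₛ (A ^ₛ k)

  prodPow : {m n : ℕ} → Vec (PS n) m → Vec ℕ m → PS n
  prodPow []       []      = oneₛ
  prodPow (G ∷ Gs) (b ∷ β) = (G ^ₛ b) *ₛ prodPow Gs β

  -- substitution F(G₁,…,G_m); this is the formal composition whenever the
  -- G_i have zero constant term (the only case in which it is used below;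
  -- terms with some exponent > total degree contribute zero then).
  _∘ₛ_ : {m n : ℕ} → PS m → Vec (PS n) m → PS n
  _∘ₛ_ {m} F Gs α = sumL (map (λ β → F β * prodPow Gs β α) (box m (total α)))

  coeff₂ : PS 2 → ℕ → ℕ → Carrier
  coeff₂ F k l = F (k ∷ l ∷ [])

  coeff₁ : PS 1 → ℕ → Carrier
  coeff₁ U j = U (j ∷ [])


  X₁ X₂ : PS 2
  X₁ = X Data.Fin.zero
  X₂ = X (Data.Fin.suc Data.Fin.zero)

  Y₁ Y₂ Y₃ : PS 3
  Y₁ = X Data.Fin.zero
  Y₂ = X (Data.Fin.suc Data.Fin.zero)
  Y₃ = X (Data.Fin.suc (Data.Fin.suc Data.Fin.zero))

  IsFGL : PS 2 → Set ℓ
  IsFGL F =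
      (F ∘ₛ (τ ∷ zeroₛ ∷ [])) ≋ τ
    × (F ∘ₛ (X₂ ∷ X₁ ∷ [])) ≋ F
    × (F ∘ₛ ((F ∘ₛ (Y₁ ∷ Y₂ ∷ [])) ∷ Y₃ ∷ []))
        ≋ (F ∘ₛ (Y₁ ∷ (F ∘ₛ (Y₂ ∷ Y₃ ∷ [])) ∷ []))

  IsHom : PS 2 → PS 2 → PS 1 → Set ℓ
  IsHom F F′ U =
      (coeff₁ U 0 ≈ 0#)
    × (U ∘ₛ (F ∷ [])) ≋ (F′ ∘ₛ ((U ∘ₛ (X₁ ∷ [])) ∷ (U ∘ₛ (X₂ ∷ [])) ∷ []))

  mulF : PS 2 → ℕ → PS 1
  mulF F zero          = zeroₛ
  mulF F (suc zero)    = τ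
  mulF F (suc (suc n)) = F ∘ₛ (mulF F (suc n) ∷ τ ∷ [])

  FactorsThrough : ℕ → PS 1 → ℕ → Set (c Level.⊔ ℓ)
  FactorsThrough p U h = Σ (PS 1) λ V → U ≋ (V ∘ₛ ((τ ^ₛ (p ℕ.^ h)) ∷ []))

  HeightSeries : ℕ → PS 1 → ℕ → Set (c Level.⊔ ℓ)
  HeightSeries p U h = FactorsThrough p U h × (∀ h′ → FactorsThrough p U h′ → h′ ≤ h)

  HeightFGL : ℕ → PS 2 → ℕ → Set (c Level.⊔ ℓ)
  HeightFGL p F h = HeightSeries p (mulF F p) h

  FirstNonzero : PS 1 → ℕ → Set ℓ
  FirstNonzero U n = (¬ (coeff₁ U n ≈ 0#)) × (∀ m → m < n → coeff₁ U m ≈ 0#)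

  valuation : {i N : ℕ} → PS 1 → PS 2 → PS 2 → Var i N → Carrier
  valuation U F F′ (u j _)    = coeff₁ U j
  valuation U F F′ (f k l _)  = coeff₂ F k l
  valuation U F F′ (f′ k l _) = coeff₂ F′ k l

-- Compare the coefficients of τ^(q i) in U ∘ [p]_F = [p]_F′ ∘ U.  Both multiplication series are
-- series in τ^q.  With W the truncation of U to the terms u_j, j < i, the left side exceeds
-- (W ∘ [p]_F) by exactly v₁^i u_i, since [p]_F has order q and (v₁ τ^q + …)^i starts at τ^(q i).
-- On the right the summand of index q m is a multiple of (U^m)^q, whose τ^(q i)-coefficient is by
-- Frobenius the q-th power of the τ^i-coefficient of U^m, and that one involves u_i only for m = 1;
-- so the right side exceeds ([p]_F′ ∘ W) by v₁′ u_i^q.  Hence C_i is the τ^(q i)-coefficient of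
-- W ∘ [p]_F - [p]_F′ ∘ W, computed with indeterminates in place of the u_j, f_kl and f′_kl.
--
-- The first nonzero coefficient of [p]_F sits at τ^q: otherwise [p] X ⊞ [p] Y ≡ [p] X modulo Y^(q+1),
-- and comparing coefficients of X^(q (m - 1)) Y^q in [p](X ⊞ Y) shows inductively that the
-- coefficient of τ^(q m) in [p]_F is killed by m^q, so it vanishes for p ∤ m and the height exceeds h.
module Submission where

open import Defs hiding (u; f; f′)
open import Level using (Level; 0ℓ)
open import Algebra.Bundles using (CommutativeRing; Semiring)
open import Algebra.Bundles.Raw using (RawSemiring)
open import Algebra.Morphism.Structures using (IsSemiringHomomorphism)
open import Algebra.Structures using (IsCommutativeRing)
open import Data.Bool using (true; false; if_then_else_; _∧_)
open import Data.Fin as Fin using (Fin)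
open import Data.Fin.Properties using (toℕ-inject₁; toℕ-fromℕ; toℕ<n)
open import Data.List as List using (List; []; _∷_; map; concatMap; upTo; applyUpTo)
open import Data.Nat as ℕ using (ℕ; suc; _≤_; _<_; _^_; _∸_; z≤n; s≤s; _≡ᵇ_; _!)
open import Data.Nat.Combinatorics using (k![n∸k]!∣n!; nCn≡1) renaming (_C_ to _choose_)
open import Data.Nat.Combinatorics.Specification using (nCk≡n!/k![n-k]!)
open import Data.Nat.Coprimality using (Coprime; coprime-Bézout)
open import Data.Nat.Divisibility as ∣ using (_∣_; _∤_; divides)
open import Data.Nat.DivMod using (m/n*n≡m)
open import Data.Nat.GCD using (module Bézout)
open import Data.Nat.Induction using (<-rec)
open import Data.Nat.Primality
  using (Prime; euclidsLemma; prime⇒nonTrivial; prime⇒nonZero; prime⇒irreducible; ¬prime[0])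
import Data.Nat.Properties as ℕₚ
open import Data.Nat.Properties using (_!*_!≢0)
open import Data.Product using (Σ; _×_; _,_; proj₁; proj₂)
open import Data.Sum using (_⊎_; inj₁; inj₂)
open import Data.Unit using (⊤; tt)
open import Data.Vec as Vec using (Vec; []; _∷_; lookup; zipWith)
open import Data.Vec.Relation.Binary.Pointwise.Inductive using (Pointwise; []; _∷_)
open import Data.Vec.Relation.Unary.All using (All; []; _∷_)
open import Function using (_∘_)
open import Relation.Binary.Definitions using (Tri; tri<; tri≈; tri>)
open import Relation.Binary.PropositionalEquality as ≡ using (_≡_; _≢_)
open import Relation.Nullary using (¬_; Dec; yes; no; contradiction)

-- Substitution is the main obstacle. `_∘ₛ_` cuts its sum at a bound that depends on the coefficient
-- asked for, so the laws of composition are not formal. They are obtained in the ring of series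
-- modulo total degree > D. There a series without constant term is nilpotent, substitution is
-- evaluation of a polynomial, and evaluation is a ring homomorphism. Associativity of composition
-- is then the naturality of evaluation under such a homomorphism. The polynomial C has to be fixed
-- before R is known. It is the series expression itself, computed with syntactic polynomials as
-- coefficients, and only evaluation into R has to respect the operations. Since the indeterminates
-- f_kl stop at k + l = q i, the symbolic series are truncations that no longer satisfy the axioms
-- of a formal group law. This is harmless: the coefficients of [p]_F up to degree q i depend only
-- on those of F up to the same degree.

-- Finite sums over ranges and over boxes of exponents

module FiniteSum {c ℓ : Level} (R : CommutativeRing c ℓ) where
  open CommutativeRing R
  open Series R using (sumL; box; total)
  open import Relation.Binary.Reasoning.Setoid setoid
  open import Algebra.Properties.CommutativeSemigroup +-commutativeSemigroup
    using (interchange)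

  Σ< : ℕ → (ℕ → Carrier) → Carrier
  Σ< 0       f = 0#
  Σ< (suc n) f = f 0 + Σ< n (λ k → f (suc k))

  Σ-cong : ∀ n {f g} → (∀ k → k < n → f k ≈ g k) → Σ< n f ≈ Σ< n g
  Σ-cong 0       f≈g = refl
  Σ-cong (suc n) f≈g =
    +-cong (f≈g 0 (s≤s z≤n)) (Σ-cong n (λ k k<n → f≈g (suc k) (s≤s k<n)))

  Σ-zero : ∀ n {f} → (∀ k → k < n → f k ≈ 0#) → Σ< n f ≈ 0#
  Σ-zero 0       f≈0 = refl
  Σ-zero (suc n) f≈0 = trans
    (+-cong (f≈0 0 (s≤s z≤n)) (Σ-zero n (λ k k<n → f≈0 (suc k) (s≤s k<n))))
    (+-identityˡ 0#)

  Σ-+ : ∀ n f g → Σ< n (λ k → f k + g k) ≈ Σ< n f + Σ< n g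
  Σ-+ 0       f g = sym (+-identityˡ 0#)
  Σ-+ (suc n) f g = trans (+-congˡ (Σ-+ n _ _)) (interchange _ _ _ _)

  Σ-*ˡ : ∀ n x f → x * Σ< n f ≈ Σ< n (λ k → x * f k)
  Σ-*ˡ 0       x f = zeroʳ x
  Σ-*ˡ (suc n) x f = trans (distribˡ x _ _) (+-congˡ (Σ-*ˡ n x _))

  Σ-last : ∀ n f → Σ< (suc n) f ≈ Σ< n f + f n
  Σ-last 0       f = +-comm _ _
  Σ-last (suc n) f =
    trans (+-congˡ (Σ-last n (λ k → f (suc k)))) (sym (+-assoc _ _ _))

  -- The form in which U and its truncation W are compared: the sums that express their coefficients
  -- differ in a single summand.
  Σ-except : ∀ {n} {f g} j {x} → j < n → (∀ k → k < n → k ≢ j → f k ≈ g k) →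
             f j ≈ g j + x → Σ< n f ≈ Σ< n g + x
  Σ-except {suc n} {f} {g} 0 {x} _ f≈g fj = begin
    f 0 + Σ< n (λ k → f (suc k))        ≈⟨ +-cong fj (Σ-cong n λ k k<n → f≈g (suc k) (s≤s k<n) λ ()) ⟩
    (g 0 + x) + Σ< n (λ k → g (suc k))  ≈⟨ +-assoc _ _ _ ⟩
    g 0 + (x + Σ< n (λ k → g (suc k)))  ≈⟨ +-congˡ (+-comm _ _) ⟩
    g 0 + (Σ< n (λ k → g (suc k)) + x)  ≈⟨ +-assoc _ _ _ ⟨
    Σ< (suc n) g + x                    ∎
  Σ-except {suc n} (suc j) (s≤s j<n) f≈g fj = trans
    (+-cong (f≈g 0 (s≤s z≤n) λ ())
            (Σ-except j j<n (λ k k<n k≢j → f≈g (suc k) (s≤s k<n) (k≢j ∘ ℕₚ.suc-injective)) fj))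
    (sym (+-assoc _ _ _))

  Σ-single : ∀ {n} {f} j → j < n → (∀ k → k < n → k ≢ j → f k ≈ 0#) → Σ< n f ≈ f j
  Σ-single {n} {f} j j<n f≈0 = begin
    Σ< n f                   ≈⟨ Σ-except {g = λ _ → 0#} j j<n f≈0 (sym (+-identityˡ _)) ⟩
    Σ< n (λ _ → 0#) + f j    ≈⟨ +-congʳ (Σ-zero n (λ _ _ → refl)) ⟩
    0# + f j                 ≈⟨ +-identityˡ _ ⟩
    f j                      ∎

  Σ-extend : ∀ {m n} {f} → m ≤ n → (∀ k → m ≤ k → f k ≈ 0#) → Σ< m f ≈ Σ< n f
  Σ-extend {n = n} z≤n f≈0 = sym (Σ-zero n (λ k _ → f≈0 k z≤n))
  Σ-extend (s≤s m≤n)       f≈0 = +-congˡ (Σ-extend m≤n (λ k m≤k → f≈0 (suc k) (s≤s m≤k)))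

  sumL-cong : ∀ {A : Set} {f g : A → Carrier} (xs : List A) →
              (∀ x → f x ≈ g x) → sumL (map f xs) ≈ sumL (map g xs)
  sumL-cong []       f≈g = refl
  sumL-cong (x ∷ xs) f≈g = +-cong (f≈g x) (sumL-cong xs f≈g)

  sumL-++ : ∀ {A : Set} (f : A → Carrier) xs ys →
            sumL (map f (xs List.++ ys)) ≈ sumL (map f xs) + sumL (map f ys)
  sumL-++ f []       ys = sym (+-identityˡ _)
  sumL-++ f (x ∷ xs) ys = trans (+-congˡ (sumL-++ f xs ys)) (sym (+-assoc _ _ _))

  sumL-map : ∀ {A B : Set} (f : B → Carrier) (g : A → B) xs →
             sumL (map f (map g xs)) ≈ sumL (map (f ∘ g) xs)
  sumL-map f g []       = refl
  sumL-map f g (x ∷ xs) = +-congˡ (sumL-map f g xs)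

  sumL-concatMap-upTo : ∀ {A : Set} (f : A → Carrier) (g : ℕ → List A) n →
    sumL (map f (concatMap g (upTo n))) ≈ Σ< n (λ k → sumL (map f (g k)))
  sumL-concatMap-upTo {A} f g n = go n (λ k → k)
    where
    -- `upTo n` is `applyUpTo` of the identity, whose recursion turns the function `e` into
    -- `e ∘ suc`, so the induction needs an arbitrary `e`.
    go : ∀ n (e : ℕ → ℕ) →
         sumL (map f (concatMap g (applyUpTo e n))) ≈ Σ< n (λ k → sumL (map f (g (e k))))
    go 0       e = refl
    go (suc n) e = trans (sumL-++ f (g (e 0)) (concatMap g (applyUpTo (e ∘ suc) n)))
                         (+-congˡ (go n (e ∘ suc)))

  Σbox : ∀ m → ℕ → (Vec ℕ m → Carrier) → Carrier
  Σbox 0       d f = f []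
  Σbox (suc m) d f = Σ< (suc d) (λ k → Σbox m d (λ β → f (k ∷ β)))

  sumL-box : ∀ m d f → sumL (map f (box m d)) ≈ Σbox m d f
  sumL-box 0       d f = +-identityʳ _
  sumL-box (suc m) d f = trans (sumL-concatMap-upTo f (λ k → map (k ∷_) (box m d)) (suc d))
    (Σ-cong (suc d) (λ k _ → trans (sumL-map f (k ∷_) (box m d))
                                   (sumL-box m d (λ β → f (k ∷ β)))))

  Σbox-cong : ∀ m d {f g} → (∀ β → f β ≈ g β) → Σbox m d f ≈ Σbox m d g
  Σbox-cong 0       d f≈g = f≈g []
  Σbox-cong (suc m) d f≈g = Σ-cong (suc d) (λ k _ → Σbox-cong m d (λ β → f≈g (k ∷ β)))

  Σbox-zero : ∀ m d {f} → (∀ β → f β ≈ 0#) → Σbox m d f ≈ 0#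
  Σbox-zero 0       d f≈0 = f≈0 []
  Σbox-zero (suc m) d f≈0 = Σ-zero (suc d) (λ k _ → Σbox-zero m d (λ β → f≈0 (k ∷ β)))

  Σbox-*ˡ : ∀ m d x f → x * Σbox m d f ≈ Σbox m d (λ β → x * f β)
  Σbox-*ˡ 0       d x f = refl
  Σbox-*ˡ (suc m) d x f = trans (Σ-*ˡ (suc d) x (λ k → Σbox m d (λ β → f (k ∷ β))))
    (Σ-cong (suc d) (λ k _ → Σbox-*ˡ m d x (λ β → f (k ∷ β))))

  -- Replaces the bound of `_∘ₛ_`, which is the degree of the coefficient asked for, by one bound
  -- common to all coefficients.
  Σbox-extend : ∀ m {d D f} → d ≤ D → (∀ β → d < total β → f β ≈ 0#) →
                Σbox m d f ≈ Σbox m D f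
  Σbox-extend 0       d≤D f≈0 = refl
  Σbox-extend (suc m) {d} {D} d≤D f≈0 = trans
    (Σ-cong (suc d) (λ k _ → Σbox-extend m d≤D
      (λ β d<β → f≈0 (k ∷ β) (ℕₚ.≤-trans d<β (ℕₚ.m≤n+m _ k)))))
    (Σ-extend (s≤s d≤D) (λ k d<k → Σbox-zero m D
      (λ β → f≈0 (k ∷ β) (ℕₚ.≤-trans d<k (ℕₚ.m≤m+n k _)))))

-- Cauchy products of sequences

module Convolution {c ℓ : Level} (R : CommutativeRing c ℓ) where
  open CommutativeRing R
  open FiniteSum R
  open import Relation.Binary.Reasoning.Setoid setoid

  -- (a ⋆ b) (suc k) unfolds to a 0 * b (suc k) + ((a ∘ suc) ⋆ b) k, on which the inductions rest.
  infixl 7 _⋆_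
  _⋆_ : (ℕ → Carrier) → (ℕ → Carrier) → ℕ → Carrier
  (a ⋆ b) k = Σ< (suc k) (λ j → a j * b (k ∸ j))

  ⋆-cong : ∀ {a a′ b b′} → (∀ k → a k ≈ a′ k) → (∀ k → b k ≈ b′ k) →
           ∀ k → (a ⋆ b) k ≈ (a′ ⋆ b′) k
  ⋆-cong a≈ b≈ k = Σ-cong (suc k) (λ j _ → *-cong (a≈ j) (b≈ (k ∸ j)))

  -- Unfolding `_⋆_` peels off the first term of the left factor; commutativity also needs the
  -- mirror image of this recursion.
  ⋆-sucʳ : ∀ a b k → (a ⋆ b) (suc k) ≈ (a ⋆ (b ∘ suc)) k + a (suc k) * b 0
  ⋆-sucʳ a b 0       = +-cong (sym (+-identityʳ _)) (+-identityʳ _)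
  ⋆-sucʳ a b (suc k) = trans (+-congˡ (⋆-sucʳ (a ∘ suc) b k)) (sym (+-assoc _ _ _))

  ⋆-comm : ∀ a b k → (a ⋆ b) k ≈ (b ⋆ a) k
  ⋆-comm a b 0       = +-congʳ (*-comm _ _)
  ⋆-comm a b (suc k) = begin
    a 0 * b (suc k) + ((a ∘ suc) ⋆ b) k  ≈⟨ +-cong (*-comm _ _) (⋆-comm (a ∘ suc) b k) ⟩
    b (suc k) * a 0 + (b ⋆ (a ∘ suc)) k  ≈⟨ +-comm _ _ ⟩
    (b ⋆ (a ∘ suc)) k + b (suc k) * a 0  ≈⟨ ⋆-sucʳ b a k ⟨
    (b ⋆ a) (suc k)                      ∎

  ⋆-distribʳ : ∀ a b d k → ((λ j → a j + b j) ⋆ d) k ≈ (a ⋆ d) k + (b ⋆ d) k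
  ⋆-distribʳ a b d k = trans (Σ-cong (suc k) (λ j _ → distribʳ (d (k ∸ j)) (a j) (b j)))
                             (Σ-+ (suc k) (λ j → a j * d (k ∸ j)) (λ j → b j * d (k ∸ j)))

  ⋆-*ˡ : ∀ x a b k → ((λ j → x * a j) ⋆ b) k ≈ x * (a ⋆ b) k
  ⋆-*ˡ x a b k = trans (Σ-cong (suc k) (λ j _ → *-assoc x (a j) (b (k ∸ j))))
                         (sym (Σ-*ˡ (suc k) x (λ j → a j * b (k ∸ j))))

  ⋆-assoc : ∀ a b d k → ((a ⋆ b) ⋆ d) k ≈ (a ⋆ (b ⋆ d)) k
  ⋆-assoc a b d 0 = +-congʳ (begin
    (a 0 * b 0 + 0#) * d 0  ≈⟨ *-congʳ (+-identityʳ _) ⟩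
    a 0 * b 0 * d 0         ≈⟨ *-assoc _ _ _ ⟩
    a 0 * (b 0 * d 0)       ≈⟨ *-congˡ (+-identityʳ _) ⟨
    a 0 * (b 0 * d 0 + 0#)  ∎)
  ⋆-assoc a b d (suc k) = begin
    (a 0 * b 0 + 0#) * d (suc k) + (((a ⋆ b) ∘ suc) ⋆ d) k
      ≈⟨ +-cong (*-congʳ (+-identityʳ _))
                (⋆-distribʳ (λ j → a 0 * b (suc j)) ((a ∘ suc) ⋆ b) d k) ⟩
    a 0 * b 0 * d (suc k) + (((λ j → a 0 * b (suc j)) ⋆ d) k + (((a ∘ suc) ⋆ b) ⋆ d) k)
      ≈⟨ +-cong (*-assoc _ _ _) (+-cong (⋆-*ˡ (a 0) (b ∘ suc) d k) (⋆-assoc (a ∘ suc) b d k)) ⟩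
    a 0 * (b 0 * d (suc k)) + (a 0 * ((b ∘ suc) ⋆ d) k + ((a ∘ suc) ⋆ (b ⋆ d)) k)
      ≈⟨ +-assoc _ _ _ ⟨
    a 0 * (b 0 * d (suc k)) + a 0 * ((b ∘ suc) ⋆ d) k + ((a ∘ suc) ⋆ (b ⋆ d)) k
      ≈⟨ +-congʳ (distribˡ _ _ _) ⟨
    a 0 * (b ⋆ d) (suc k) + ((a ∘ suc) ⋆ (b ⋆ d)) k ∎

-- Multiplicativity of polynomial evaluation at a nilpotent element

module Horner {c ℓ : Level} (R : CommutativeRing c ℓ) where
  open CommutativeRing R
  open Series R using (_^ᴿ_)
  open FiniteSum R
  open Convolution R
  open import Relation.Binary.Reasoning.Setoid setoid
  open import Algebra.Solver.Ring.NaturalCoefficients.Default commutativeSemiring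
    using (solve; _:=_; _:+_; _:*_)

  poly : ℕ → Carrier → (ℕ → Carrier) → Carrier
  poly n g a = Σ< n (λ k → (g ^ᴿ k) * a k)

  poly-suc : ∀ n g a → poly (suc n) g a ≈ a 0 + g * poly n g (a ∘ suc)
  poly-suc n g a = +-cong (*-identityˡ _) (trans
    (Σ-cong n (λ k _ → *-assoc g (g ^ᴿ k) (a (suc k))))
    (sym (Σ-*ˡ n g (λ k → (g ^ᴿ k) * a (suc k)))))

  poly-cong : ∀ n g {a b} → (∀ k → k < n → a k ≈ b k) → poly n g a ≈ poly n g b
  poly-cong n g a≈b = Σ-cong n (λ k k<n → *-congˡ (a≈b k k<n))

  poly-+ : ∀ n g a b → poly n g (λ k → a k + b k) ≈ poly n g a + poly n g b
  poly-+ n g a b = trans (Σ-cong n (λ k _ → distribˡ (g ^ᴿ k) (a k) (b k)))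
    (Σ-+ n (λ k → (g ^ᴿ k) * a k) (λ k → (g ^ᴿ k) * b k))

  poly-*ˡ : ∀ n g x a → poly n g (λ k → x * a k) ≈ x * poly n g a
  poly-*ˡ n g x a = trans
    (Σ-cong n (λ k _ → solve 3 (λ y x z → y :* (x :* z) := x :* (y :* z)) refl (g ^ᴿ k) x (a k)))
    (sym (Σ-*ˡ n x (λ k → (g ^ᴿ k) * a k)))

  -- The factor z carries the induction: g ^ n ≈ 0 does not descend to
  -- n - 1, but z * g ^ n ≈ 0 does, with z replaced by z * g.
  poly-⋆-scaled : ∀ n g z a b → z * (g ^ᴿ n) ≈ 0# →
                  z * poly n g (a ⋆ b) ≈ z * (poly n g a * poly n g b)
  poly-⋆-scaled 0       g z a b _ = *-congˡ (sym (zeroˡ 0#))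
  poly-⋆-scaled (suc n) g z a b zgⁿ≈0 = begin
    z * poly (suc n) g (a ⋆ b)
      ≈⟨ *-congˡ expand ⟩
    z * (a 0 * B + g * poly n g (a′ ⋆ b))
      ≈⟨ solve 5 (λ z x y g w → z :* (x :* y :+ g :* w) := z :* (x :* y) :+ (z :* g) :* w)
               refl z (a 0) B g (poly n g (a′ ⋆ b)) ⟩
    z * (a 0 * B) + (z * g) * poly n g (a′ ⋆ b)
      ≈⟨ +-congˡ (poly-⋆-scaled n g (z * g) a′ b (trans (*-assoc _ _ _) zgⁿ≈0)) ⟩
    z * (a 0 * B) + (z * g) * (A′ * poly n g b)
      ≈⟨ +-congˡ last ⟨
    z * (a 0 * B) + (z * g) * (A′ * B)
      ≈⟨ solve 5 (λ z x y g w → z :* (x :* y) :+ (z :* g) :* (w :* y) := z :* ((x :+ g :* w) :* y))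
               refl z (a 0) B g A′ ⟩
    z * ((a 0 + g * A′) * B)
      ≈⟨ *-congˡ (*-congʳ (poly-suc n g a)) ⟨
    z * (poly (suc n) g a * B) ∎
    where
    a′ = a ∘ suc
    A′ = poly n g a′
    B  = poly (suc n) g b

    expand : poly (suc n) g (a ⋆ b) ≈ a 0 * B + g * poly n g (a′ ⋆ b)
    expand = begin
      poly (suc n) g (a ⋆ b)
        ≈⟨ poly-suc n g (a ⋆ b) ⟩
      (a 0 * b 0 + 0#) + g * poly n g (λ k → a 0 * b (suc k) + (a′ ⋆ b) k)
        ≈⟨ +-cong (+-identityʳ _) (*-congˡ (trans
             (poly-+ n g (λ k → a 0 * b (suc k)) (a′ ⋆ b))
             (+-congʳ (poly-*ˡ n g (a 0) (b ∘ suc))))) ⟩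
      a 0 * b 0 + g * (a 0 * poly n g (b ∘ suc) + poly n g (a′ ⋆ b))
        ≈⟨ solve 5 (λ x y g v w → x :* y :+ g :* (x :* v :+ w) := x :* (y :+ g :* v) :+ g :* w)
                 refl (a 0) (b 0) g (poly n g (b ∘ suc)) (poly n g (a′ ⋆ b)) ⟩
      a 0 * (b 0 + g * poly n g (b ∘ suc)) + g * poly n g (a′ ⋆ b)
        ≈⟨ +-congʳ (*-congˡ (poly-suc n g b)) ⟨
      a 0 * B + g * poly n g (a′ ⋆ b) ∎

    -- The induction hypothesis produces `b` cut one term earlier than `B`. The term in between
    -- carries z * g ^ (n + 1), which is zero by hypothesis.
    last : (z * g) * (A′ * B) ≈ (z * g) * (A′ * poly n g b)
    last = begin
      (z * g) * (A′ * B)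
        ≈⟨ *-congˡ (*-congˡ (Σ-last n (λ k → (g ^ᴿ k) * b k))) ⟩
      (z * g) * (A′ * (poly n g b + (g ^ᴿ n) * b n))
        ≈⟨ solve 6 (λ z g w y v u → (z :* g) :* (w :* (y :+ v :* u))
                     := (z :* g) :* (w :* y) :+ (z :* (g :* v)) :* (w :* u))
                 refl z g A′ (poly n g b) (g ^ᴿ n) (b n) ⟩
      (z * g) * (A′ * poly n g b) + (z * (g * (g ^ᴿ n))) * (A′ * b n)
        ≈⟨ +-congˡ (trans (*-congʳ zgⁿ≈0) (zeroˡ _)) ⟩
      (z * g) * (A′ * poly n g b) + 0#
        ≈⟨ +-identityʳ _ ⟩
      (z * g) * (A′ * poly n g b) ∎

  poly-⋆ : ∀ n g a b → g ^ᴿ n ≈ 0# → poly n g (a ⋆ b) ≈ poly n g a * poly n g b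
  poly-⋆ n g a b gⁿ≈0 = begin
    poly n g (a ⋆ b)                   ≈⟨ *-identityˡ _ ⟨
    1# * poly n g (a ⋆ b)              ≈⟨ poly-⋆-scaled n g 1# a b (trans (*-identityˡ _) gⁿ≈0) ⟩
    1# * (poly n g a * poly n g b)     ≈⟨ *-identityˡ _ ⟩
    poly n g a * poly n g b            ∎

-- Binomial coefficients and powers in characteristic p

prime∤! : ∀ {p} → Prime p → ∀ {n} → n < p → p ∤ n !
prime∤! pp {0}     n<p p∣1  =
  ℕ.nonTrivial⇒≢1 {{prime⇒nonTrivial pp}} (∣.∣1⇒≡1 p∣1)
prime∤! pp {suc n} n<p p∣n! with euclidsLemma (suc n) (n !) pp p∣n!
... | inj₁ p∣sn = ∣.>⇒∤ n<p p∣sn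
... | inj₂ p∣n  = prime∤! pp (ℕₚ.<-trans (ℕₚ.n<1+n n) n<p) p∣n

-- p divides p!, which is the binomial coefficient times k! (p - k)!, and it divides neither of
-- these two factorials.
prime∣choose : ∀ {p} → Prime p → ∀ {k} → 0 < k → k < p → p ∣ p choose k
prime∣choose {p} pp {k} 0<k k<p
  with euclidsLemma (p choose k) (k ! ℕ.* (p ∸ k) !) pp
         (≡.subst (p ∣_) (≡.sym choose*k![p-k]!≡p!) (n∣n! (ℕₚ.<-trans 0<k k<p)))
  where
  n∣n! : ∀ {n} → 0 < n → n ∣ n !
  n∣n! {suc n} _ = ∣.m∣m*n (n !)
  choose*k![p-k]!≡p! : (p choose k) ℕ.* (k ! ℕ.* (p ∸ k) !) ≡ p !
  choose*k![p-k]!≡p! = ≡.trans (≡.cong (ℕ._* (k ! ℕ.* (p ∸ k) !)) (nCk≡n!/k![n-k]! (ℕₚ.<⇒≤ k<p)))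
    (m/n*n≡m {{k !* (p ∸ k) !≢0}} (k![n∸k]!∣n! (ℕₚ.<⇒≤ k<p)))
... | inj₁ p∣choose = p∣choose
... | inj₂ p∣! with euclidsLemma (k !) ((p ∸ k) !) pp p∣!
...   | inj₁ p∣k!     = contradiction p∣k! (prime∤! pp k<p)
...   | inj₂ p∣[p-k]! = contradiction p∣[p-k]! (prime∤! pp (ℕₚ.∸-monoʳ-< 0<k (ℕₚ.<⇒≤ k<p)))

module Powers {c ℓ : Level} (S : CommutativeRing c ℓ) where
  open CommutativeRing S
  open Series S using (_^ᴿ_; natR)
  open import Algebra.Properties.Semiring.Exp semiring using (^-assocʳ) renaming (_^_ to _^ᴹ_)
  open import Algebra.Properties.CommutativeSemiring.Exp commutativeSemiring using (^-distrib-*)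
  open import Algebra.Properties.Semiring.Mult semiring using (×-congˡ; ×-assocˡ; ×1-homo-*)
    renaming (_×_ to _×ᴹ_)
  open import Algebra.Properties.CommutativeSemiring.Binomial commutativeSemiring
    using (theorem; binomialTerm)
  open import Algebra.Properties.Monoid.Sum +-monoid
    using (sum; sum-init-last; sum-cong-≋; sum-replicate-zero)
  open import Relation.Binary.Reasoning.Setoid setoid

  ^ᴹ≡^ᴿ : ∀ x k → x ^ᴹ k ≡ x ^ᴿ k
  ^ᴹ≡^ᴿ x 0       = ≡.refl
  ^ᴹ≡^ᴿ x (suc k) = ≡.cong (x *_) (^ᴹ≡^ᴿ x k)

  ^ᴿ-assoc : ∀ x m n → (x ^ᴿ m) ^ᴿ n ≈ x ^ᴿ (m ℕ.* n)
  ^ᴿ-assoc x m n rewrite ≡.sym (^ᴹ≡^ᴿ x m) | ≡.sym (^ᴹ≡^ᴿ (x ^ᴹ m) n) | ≡.sym (^ᴹ≡^ᴿ x (m ℕ.* n)) =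
    ^-assocʳ x m n

  ^ᴿ-cong : ∀ {x y} k → x ≈ y → x ^ᴿ k ≈ y ^ᴿ k
  ^ᴿ-cong 0       x≈y = refl
  ^ᴿ-cong (suc k) x≈y = *-cong x≈y (^ᴿ-cong k x≈y)

  0^ᴿ≈0 : ∀ {x k} → 0 < k → x ≈ 0# → x ^ᴿ k ≈ 0#
  0^ᴿ≈0 {k = suc k} _ x≈0 = trans (*-congʳ x≈0) (zeroˡ _)

  ^ᴿ-distrib-* : ∀ x y k → (x * y) ^ᴿ k ≈ (x ^ᴿ k) * (y ^ᴿ k)
  ^ᴿ-distrib-* x y k rewrite ≡.sym (^ᴹ≡^ᴿ (x * y) k) | ≡.sym (^ᴹ≡^ᴿ x k) | ≡.sym (^ᴹ≡^ᴿ y k) =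
    ^-distrib-* x y k

  ×≈natR* : ∀ n x → n ×ᴹ x ≈ natR n * x
  ×≈natR* 0       x = sym (zeroˡ x)
  ×≈natR* (suc n) x = trans (+-cong (sym (*-identityˡ x)) (×≈natR* n x)) (sym (distribʳ x 1# (natR n)))

  natR≡×1 : ∀ n → natR n ≡ n ×ᴹ 1#
  natR≡×1 0       = ≡.refl
  natR≡×1 (suc n) = ≡.cong (1# +_) (natR≡×1 n)

  natR-* : ∀ m n → natR (m ℕ.* n) ≈ natR m * natR n
  natR-* m n rewrite natR≡×1 (m ℕ.* n) | natR≡×1 m | natR≡×1 n = ×1-homo-* m n

  module _ {p : ℕ} (char : natR p ≈ 0#) where
    ∣⇒natR≈0 : ∀ {n} → p ∣ n → natR n ≈ 0#
    ∣⇒natR≈0 (divides m ≡.refl) = trans (natR-* m p) (trans (*-congˡ char) (zeroʳ _))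

    -- Otherwise n is coprime to p, and a Bézout identity for p and n, read in the ring, makes 1
    -- vanish.
    natR≈0⇒∣ : Prime p → ¬ (1# ≈ 0#) → ∀ {n} → natR n ≈ 0# → p ∣ n
    natR≈0⇒∣ pp 1≉0 {n} n≈0 with p ∣.∣? n
    ... | yes p∣n = p∣n
    ... | no  p∤n = contradiction (bézout (coprime-Bézout coprime)) 1≉0
      where
      coprime : Coprime p n
      coprime (d∣p , d∣n) with prime⇒irreducible pp d∣p
      ... | inj₁ d≡1    = d≡1
      ... | inj₂ ≡.refl = contradiction d∣n p∤n

      multiple≈0 : ∀ k {m} → natR m ≈ 0# → natR (k ℕ.* m) ≈ 0#
      multiple≈0 k {m} m≈0 = trans (natR-* k m) (trans (*-congˡ m≈0) (zeroʳ _))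

      1≈0 : ∀ {k l} → suc k ≡ l → natR k ≈ 0# → natR l ≈ 0# → 1# ≈ 0#
      1≈0 ≡.refl k≈0 l≈0 = trans (sym (trans (+-congˡ k≈0) (+-identityʳ 1#))) l≈0

      bézout : Bézout.Identity 1 p n → 1# ≈ 0#
      bézout (Bézout.+- x y eq) = 1≈0 eq (multiple≈0 y n≈0) (multiple≈0 x char)
      bézout (Bézout.-+ x y eq) = 1≈0 eq (multiple≈0 x char) (multiple≈0 y n≈0)

  sum-ends : ∀ {m} (t : Fin (suc (suc m)) → Carrier) →
             (∀ i → t (Fin.suc (Fin.inject₁ i)) ≈ 0#) → sum t ≈ t Fin.zero + t (Fin.suc (Fin.fromℕ m))
  sum-ends {m} t mid≈0 = +-congˡ (begin
    sum (t ∘ Fin.suc)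
      ≈⟨ sum-init-last (t ∘ Fin.suc) ⟩
    sum (λ i → t (Fin.suc (Fin.inject₁ i))) + t (Fin.suc (Fin.fromℕ m))
      ≈⟨ +-congʳ (trans (sum-cong-≋ mid≈0) (sum-replicate-zero m)) ⟩
    0# + t (Fin.suc (Fin.fromℕ m))
      ≈⟨ +-identityˡ _ ⟩
    t (Fin.suc (Fin.fromℕ m)) ∎)

  ∣⇒×≈0 : ∀ {p} → natR p ≈ 0# → ∀ {n} x → p ∣ n → n ×ᴹ x ≈ 0#
  ∣⇒×≈0 {p} char x (divides m ≡.refl) = begin
      (m ℕ.* p) ×ᴹ x     ≈⟨ ×-congˡ (ℕₚ.*-comm m p) ⟩
      (p ℕ.* m) ×ᴹ x     ≈⟨ ×-assocˡ x p m ⟨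
      p ×ᴹ (m ×ᴹ x)      ≈⟨ ×≈natR* p _ ⟩
      natR p * (m ×ᴹ x)  ≈⟨ *-congʳ char ⟩
      0# * (m ×ᴹ x)      ≈⟨ zeroˡ _ ⟩
      0#                 ∎

  frobenius-+ : ∀ {p} → natR p ≈ 0# → Prime p → ∀ x y → (x + y) ^ᴿ p ≈ (x ^ᴿ p) + (y ^ᴿ p)
  frobenius-+ {0}      char pp x y = contradiction pp ¬prime[0]
  frobenius-+ {suc p′} char pp x y
    rewrite ≡.sym (^ᴹ≡^ᴿ (x + y) (suc p′)) | ≡.sym (^ᴹ≡^ᴿ x (suc p′)) | ≡.sym (^ᴹ≡^ᴿ y (suc p′)) =
    begin
      (x + y) ^ᴹ p
        ≈⟨ theorem p x y ⟩
      sum (binomialTerm x y p)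
        ≈⟨ sum-ends (binomialTerm x y p) middle ⟩
      binomialTerm x y p Fin.zero + binomialTerm x y p (Fin.suc (Fin.fromℕ p′))
        ≈⟨ +-cong (trans (+-identityʳ _) (*-identityˡ _)) last ⟩
      y ^ᴹ p + x ^ᴹ p
        ≈⟨ +-comm _ _ ⟩
      x ^ᴹ p + y ^ᴹ p ∎
    where
    p = suc p′
    middle : ∀ i → binomialTerm x y p (Fin.suc (Fin.inject₁ i)) ≈ 0#
    middle i = ∣⇒×≈0 char _ (prime∣choose pp (s≤s z≤n)
      (s≤s (ℕₚ.≤-trans (ℕₚ.≤-reflexive (≡.cong suc (toℕ-inject₁ i))) (toℕ<n i))))
    last : binomialTerm x y p (Fin.suc (Fin.fromℕ p′)) ≈ x ^ᴹ p
    last rewrite toℕ-fromℕ p′ | nCn≡1 p | ℕₚ.n∸n≡0 p′ = trans (+-identityʳ _) (*-identityʳ _)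

-- The ring of power series in n variables

module PowerSeries {c ℓ : Level} (R : CommutativeRing c ℓ) where
  open CommutativeRing R
  open Series R
  open FiniteSum R
  open import Relation.Binary.Reasoning.Setoid setoid

  infixl 6 _+ₛ_
  _+ₛ_ : ∀ {n} → PS n → PS n → PS n
  (A +ₛ B) α = A α + B α

  -ₛ_ : ∀ {n} → PS n → PS n
  (-ₛ A) α = - A α

  slice : ∀ {n} → PS (suc n) → ℕ → PS n
  slice A k α = A (k ∷ α)

  *ₛ-slice : ∀ {n} (A B : PS (suc n)) a α →
             (A *ₛ B) (a ∷ α) ≈ Σ< (suc a) (λ k → (slice A k *ₛ slice B (a ∸ k)) α)
  *ₛ-slice A B a α = trans (sumL-concatMap-upTo term (λ k → map (cons k) (splits α)) (suc a))
    (Σ-cong (suc a) (λ k _ → sumL-map term (cons k) (splits α)))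
    where
    term : Vec ℕ _ × Vec ℕ _ → Carrier
    term (β , γ) = A β * B γ
    cons : ℕ → Vec ℕ _ × Vec ℕ _ → Vec ℕ _ × Vec ℕ _
    cons k (β , γ) = k ∷ β , a ∸ k ∷ γ

  infixl 6 _+ᵥ_
  _+ᵥ_ : ∀ {n} → Vec ℕ n → Vec ℕ n → Vec ℕ n
  _+ᵥ_ = zipWith ℕ._+_

  -- A coefficient of a product sees only the pairs of exponents with the right sum. The order and
  -- truncation arguments for products rest on this local form of congruence.
  *ₛ-cong-splits : ∀ {n} {A B A′ B′ : PS n} α →
    (∀ β γ → β +ᵥ γ ≡ α → A β * B γ ≈ A′ β * B′ γ) → (A *ₛ B) α ≈ (A′ *ₛ B′) α
  *ₛ-cong-splits []      eq = +-congʳ (eq [] [] ≡.refl)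
  *ₛ-cong-splits {A = A} {B} {A′} {B′} (a ∷ α) eq = begin
    (A *ₛ B) (a ∷ α)
      ≈⟨ *ₛ-slice A B a α ⟩
    Σ< (suc a) (λ k → (slice A k *ₛ slice B (a ∸ k)) α)
      ≈⟨ Σ-cong (suc a) (λ k k≤a → *ₛ-cong-splits α (λ β γ β+γ≡α →
           eq (k ∷ β) (a ∸ k ∷ γ)
              (≡.cong₂ _∷_ (ℕₚ.m+[n∸m]≡n (ℕₚ.≤-pred k≤a)) β+γ≡α))) ⟩
    Σ< (suc a) (λ k → (slice A′ k *ₛ slice B′ (a ∸ k)) α)
      ≈⟨ *ₛ-slice A′ B′ a α ⟨
    (A′ *ₛ B′) (a ∷ α) ∎

  *ₛ-cong : ∀ {n} {A B A′ B′ : PS n} → A ≋ A′ → B ≋ B′ → (A *ₛ B) ≋ (A′ *ₛ B′)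
  *ₛ-cong A≋ B≋ α = *ₛ-cong-splits α (λ β γ _ → *-cong (A≋ β) (B≋ γ))

  zeroₛ-*ₛ-zeroₛ : ∀ {n} → (zeroₛ {n} *ₛ zeroₛ) ≋ zeroₛ
  zeroₛ-*ₛ-zeroₛ []      = trans (+-identityʳ _) (zeroˡ 0#)
  zeroₛ-*ₛ-zeroₛ (a ∷ α) = trans (*ₛ-slice zeroₛ zeroₛ a α)
    (Σ-zero (suc a) (λ _ _ → zeroₛ-*ₛ-zeroₛ α))

  *ₛ-zero-splits : ∀ {n} {A B : PS n} α →
    (∀ β γ → β +ᵥ γ ≡ α → A β * B γ ≈ 0#) → (A *ₛ B) α ≈ 0#
  *ₛ-zero-splits α eq = trans
    (*ₛ-cong-splits α (λ β γ e → trans (eq β γ e) (sym (zeroˡ 0#)))) (zeroₛ-*ₛ-zeroₛ α)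

  *ₛ-zeroˡ : ∀ {n} (A : PS n) → (zeroₛ *ₛ A) ≋ zeroₛ
  *ₛ-zeroˡ A α = *ₛ-zero-splits α (λ _ γ _ → zeroˡ (A γ))

  -- By definition `oneₛ` is the case of `1#`, so the unit law is an instance of `constₛ-*ₛ`.
  constₛ : ∀ {n} → Carrier → PS n
  constₛ x α = if total α ≡ᵇ 0 then x else 0#

  constₛ-*ₛ : ∀ {n} x (A : PS n) α → (constₛ x *ₛ A) α ≈ x * A α
  constₛ-*ₛ x A []      = +-identityʳ _
  constₛ-*ₛ x A (a ∷ α) = begin
    (constₛ x *ₛ A) (a ∷ α)
      ≈⟨ *ₛ-slice (constₛ x) A a α ⟩
    (constₛ x *ₛ slice A a) α + Σ< a (λ k → (zeroₛ *ₛ slice A (a ∸ suc k)) α)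
      ≈⟨ +-cong (constₛ-*ₛ x (slice A a) α)
                (Σ-zero a (λ k _ → *ₛ-zeroˡ (slice A (a ∸ suc k)) α)) ⟩
    x * A (a ∷ α) + 0#
      ≈⟨ +-identityʳ _ ⟩
    x * A (a ∷ α) ∎

  constₛ-zero : ∀ {n} → constₛ {n} 0# ≋ zeroₛ
  constₛ-zero α with total α ≡ᵇ 0
  ... | true  = refl
  ... | false = refl

  constₛ-cong : ∀ {n x y} → x ≈ y → constₛ {n} x ≋ constₛ y
  constₛ-cong x≈y α with total α ≡ᵇ 0
  ... | true  = x≈y
  ... | false = refl

  constₛ-+ : ∀ {n} x y → constₛ {n} (x + y) ≋ (constₛ x +ₛ constₛ y)
  constₛ-+ x y α with total α ≡ᵇ 0
  ... | true  = refl
  ... | false = sym (+-identityˡ 0#)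

  constₛ-* : ∀ {n} x y → constₛ {n} (x * y) ≋ (constₛ x *ₛ constₛ y)
  constₛ-* x y α = trans (helper α) (sym (constₛ-*ₛ x (constₛ y) α))
    where
    helper : ∀ α → constₛ (x * y) α ≈ x * constₛ y α
    helper α with total α ≡ᵇ 0
    ... | true  = refl
    ... | false = sym (zeroʳ x)

  X-vanish-lookup : ∀ {n} (i : Fin n) α → lookup α i ≢ 1 → X i α ≡ 0#
  X-vanish-lookup i α α≢1 with lookup α i
  ... | 0           = ≡.refl
  ... | 1           = contradiction ≡.refl α≢1
  ... | suc (suc _) = ≡.refl

  X-vanish-total : ∀ {n} (i : Fin n) α → total α ≢ 1 → X i α ≡ 0#
  X-vanish-total i α α≢1 with lookup α i ≡ᵇ 1 | total α
  ... | false | _           = ≡.refl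
  ... | true  | 0           = ≡.refl
  ... | true  | 1           = contradiction ≡.refl α≢1
  ... | true  | suc (suc _) = ≡.refl

  lookup≤total : ∀ {n} (i : Fin n) α → lookup α i ≤ total α
  lookup≤total Fin.zero    (a ∷ α) = ℕₚ.m≤m+n a (total α)
  lookup≤total (Fin.suc i) (a ∷ α) = ℕₚ.≤-trans (lookup≤total i α) (ℕₚ.m≤n+m (total α) a)

  bundle : ∀ {n} → IsCommutativeRing (_≋_ {n}) _+ₛ_ _*ₛ_ -ₛ_ zeroₛ oneₛ → CommutativeRing c ℓ
  bundle isCR = record { isCommutativeRing = isCR }

  module _ {n : ℕ} (isCR : IsCommutativeRing (_≋_ {n}) _+ₛ_ _*ₛ_ -ₛ_ zeroₛ oneₛ) where
    open FiniteSum (bundle isCR) using () renaming (Σ< to Σₛ<)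

    -- The ring structure is a parameter because this is used inside the recursion that constructs
    -- it.
    Σ-at : ∀ k (f : ℕ → PS n) α → Σₛ< k f α ≡ Σ< k (λ j → f j α)
    Σ-at 0       f α = ≡.refl
    Σ-at (suc k) f α = ≡.cong (f 0 α +_) (Σ-at k (f ∘ suc) α)

  mkRing : ∀ {n} →
    (∀ (A B : PS n) → (A *ₛ B) ≋ (B *ₛ A)) →
    (∀ (A B C : PS n) → ((A *ₛ B) *ₛ C) ≋ (A *ₛ (B *ₛ C))) →
    (∀ (A B C : PS n) → ((A +ₛ B) *ₛ C) ≋ ((A *ₛ C) +ₛ (B *ₛ C))) →
    IsCommutativeRing (_≋_ {n}) _+ₛ_ _*ₛ_ -ₛ_ zeroₛ oneₛ
  mkRing comm assoc distʳ = record
    { isRing = record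
      { +-isAbelianGroup = record
        { isGroup = record
          { isMonoid = record
            { isSemigroup = record
              { isMagma = record
                { isEquivalence = record
                  { refl  = λ α → refl
                  ; sym   = λ p α → sym (p α)
                  ; trans = λ p q α → trans (p α) (q α)
                  }
                ; ∙-cong = λ p q α → +-cong (p α) (q α)
                }
              ; assoc = λ A B C α → +-assoc (A α) (B α) (C α)
              }
            ; identity = (λ A α → +-identityˡ (A α)) , (λ A α → +-identityʳ (A α))
            }
          ; inverse = (λ A α → -‿inverseˡ (A α)) , (λ A α → -‿inverseʳ (A α))
          ; ⁻¹-cong = λ p α → -‿cong (p α)
          }
        ; comm = λ A B α → +-comm (A α) (B α)
        }
      ; *-cong     = *ₛ-cong
      ; *-assoc    = assoc
      ; *-identity = one , (λ A α → trans (comm A oneₛ α) (one A α))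
      ; distrib    = (λ A B C α → trans (comm A (B +ₛ C) α) (trans (distʳ B C A α)
                                    (+-cong (comm B A α) (comm C A α))))
                   , (λ A B C → distʳ B C A)
      }
    ; *-comm = comm
    }
    where
    one : ∀ A → (oneₛ *ₛ A) ≋ A
    one A α = trans (constₛ-*ₛ 1# A α) (*-identityˡ (A α))

  -- Recursion on the number of variables: a series in n + 1 variables is a sequence of series in n
  -- variables, multiplied by convolution, so its laws are those of `_⋆_` over the ring already
  -- built.
  isCR : ∀ n → IsCommutativeRing (_≋_ {n}) _+ₛ_ _*ₛ_ -ₛ_ zeroₛ oneₛ
  isCR 0 = mkRing
    (λ { A B [] → +-congʳ (*-comm _ _) })
    (λ { A B C [] → +-congʳ (trans (*-congʳ (+-identityʳ _))
                     (trans (*-assoc _ _ _) (*-congˡ (sym (+-identityʳ _))))) })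
    (λ { A B C [] → trans (+-identityʳ _) (trans (distribʳ _ _ _)
                     (+-cong (sym (+-identityʳ _)) (sym (+-identityʳ _)))) })
  isCR (suc n) = mkRing comm assoc distʳ
    where
    S : CommutativeRing c ℓ
    S = bundle (isCR n)
    module S = CommutativeRing S
    open Convolution S

    slice-*ₛ : ∀ (A B : PS (suc n)) a → slice (A *ₛ B) a S.≈ (slice A ⋆ slice B) a
    slice-*ₛ A B a α = trans (*ₛ-slice A B a α)
      (reflexive (≡.sym (Σ-at (isCR n) (suc a) (λ k → slice A k *ₛ slice B (a ∸ k)) α)))

    comm : ∀ (A B : PS (suc n)) → (A *ₛ B) ≋ (B *ₛ A)
    comm A B (a ∷ α) = trans (slice-*ₛ A B a α)
      (trans (⋆-comm (slice A) (slice B) a α) (sym (slice-*ₛ B A a α)))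

    assoc : ∀ (A B C : PS (suc n)) → ((A *ₛ B) *ₛ C) ≋ (A *ₛ (B *ₛ C))
    assoc A B C (a ∷ α) = S.trans (slice-*ₛ (A *ₛ B) C a)
      (S.trans (⋆-cong {b = slice C} (slice-*ₛ A B) (λ _ → S.refl) a)
      (S.trans (⋆-assoc (slice A) (slice B) (slice C) a)
      (S.trans (⋆-cong {a = slice A} (λ _ → S.refl) (λ k → S.sym (slice-*ₛ B C k)) a)
      (S.sym (slice-*ₛ A (B *ₛ C) a))))) α

    distʳ : ∀ (A B C : PS (suc n)) → ((A +ₛ B) *ₛ C) ≋ ((A *ₛ C) +ₛ (B *ₛ C))
    distʳ A B C (a ∷ α) = S.trans (slice-*ₛ (A +ₛ B) C a)
      (S.trans (⋆-distribʳ (slice A) (slice B) (slice C) a)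
      (S.sym (S.+-cong (slice-*ₛ A C a) (slice-*ₛ B C a)))) α

  psRing : ℕ → CommutativeRing c ℓ
  psRing n = bundle (isCR n)

  open module Rₛ {n : ℕ} = CommutativeRing (psRing n) public using ()
    renaming ( refl to ≋-refl ; sym to ≋-sym ; trans to ≋-trans
             ; *-comm to *ₛ-comm ; *-assoc to *ₛ-assoc
             ; *-identityˡ to *ₛ-identityˡ ; *-identityʳ to *ₛ-identityʳ
             ; zeroʳ to *ₛ-zeroʳ )

-- Truncation, order and quotient rings

module Truncation {c ℓ : Level} (R : CommutativeRing c ℓ) where
  open CommutativeRing R
  open Series R
  open PowerSeries R
  open FiniteSum R
  open import Relation.Binary.Reasoning.Setoid setoid

  -- A down-set of exponents: the series that vanish on it form an ideal, and `quotient` is the ring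
  -- modulo this ideal.
  Closed : ∀ {n} → (Vec ℕ n → Set) → Set
  Closed L = ∀ β γ → L (β +ᵥ γ) → L β × L γ

  infix 4 _≈[_]_
  _≈[_]_ : ∀ {n} → PS n → (Vec ℕ n → Set) → PS n → Set ℓ
  A ≈[ L ] B = ∀ α → L α → A α ≈ B α

  *ₛ-cong-on : ∀ {n} {L : Vec ℕ n → Set} → Closed L → ∀ {A A′ B B′} →
               A ≈[ L ] A′ → B ≈[ L ] B′ → (A *ₛ B) ≈[ L ] (A′ *ₛ B′)
  *ₛ-cong-on {L = L} cl A≈ B≈ α Lα = *ₛ-cong-splits α λ β γ β+γ≡α →
    let Lβ , Lγ = cl β γ (≡.subst L (≡.sym β+γ≡α) Lα) in *-cong (A≈ β Lβ) (B≈ γ Lγ)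

  ^ₛ-cong-on : ∀ {n} {L : Vec ℕ n → Set} → Closed L → ∀ {A A′} →
               A ≈[ L ] A′ → ∀ k → (A ^ₛ k) ≈[ L ] (A′ ^ₛ k)
  ^ₛ-cong-on cl A≈ 0       α _ = refl
  ^ₛ-cong-on cl A≈ (suc k)     = *ₛ-cong-on cl A≈ (^ₛ-cong-on cl A≈ k)

  prodPow-cong-on : ∀ {m n} {L : Vec ℕ n → Set} → Closed L → {Gs Gs′ : Vec (PS n) m} →
    Pointwise _≈[ L ]_ Gs Gs′ → ∀ β → prodPow Gs β ≈[ L ] prodPow Gs′ β
  prodPow-cong-on cl []         []      α _ = refl
  prodPow-cong-on cl (G≈ ∷ Gs≈) (b ∷ β)     =
    *ₛ-cong-on cl (^ₛ-cong-on cl G≈ b) (prodPow-cong-on cl Gs≈ β)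

  ∘ₛ-cong-on : ∀ {m n} {L : Vec ℕ n → Set} → Closed L → (A : PS m) → ∀ {Gs Gs′} →
    Pointwise _≈[ L ]_ Gs Gs′ → (A ∘ₛ Gs) ≈[ L ] (A ∘ₛ Gs′)
  ∘ₛ-cong-on {m} cl A Gs≈ α Lα = sumL-cong (box m (total α))
    (λ β → *-congˡ (prodPow-cong-on cl Gs≈ β α Lα))

  total-+ᵥ : ∀ {n} (β γ : Vec ℕ n) → total (β +ᵥ γ) ≡ total β ℕ.+ total γ
  total-+ᵥ []      []      = ≡.refl
  total-+ᵥ (b ∷ β) (d ∷ γ) = ≡.trans (≡.cong (b ℕ.+ d ℕ.+_) (total-+ᵥ β γ))
    (interchange b d (total β) (total γ))
    where open import Algebra.Properties.CommutativeSemigroup ℕₚ.+-commutativeSemigroup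

  Total≤ : ∀ {n} → ℕ → Vec ℕ n → Set
  Total≤ D α = total α ≤ D

  closed-Total≤ : ∀ {n} D → Closed {n} (Total≤ D)
  closed-Total≤ D β γ h rewrite total-+ᵥ β γ = ℕₚ.m+n≤o⇒m≤o (total β) h , ℕₚ.m+n≤o⇒n≤o (total β) h

  Order≥ : ∀ {n} → ℕ → PS n → Set ℓ
  Order≥ k A = ∀ α → total α < k → A α ≈ 0#

  order-*ₛ : ∀ {n} {A B : PS n} a b → Order≥ a A → Order≥ b B → Order≥ (a ℕ.+ b) (A *ₛ B)
  order-*ₛ a b oA oB α α<a+b = *ₛ-zero-splits α helper
    where
    helper : ∀ β γ → β +ᵥ γ ≡ α → _
    helper β γ ≡.refl with total β ℕ.<? a
    ... | yes β<a = trans (*-congʳ (oA β β<a)) (zeroˡ _)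
    ... | no  β≮a with total γ ℕ.<? b
    ...   | yes γ<b = trans (*-congˡ (oB γ γ<b)) (zeroʳ _)
    ...   | no  γ≮b = contradiction
      (ℕₚ.≤-trans (ℕₚ.≤-reflexive (≡.cong suc (≡.sym (total-+ᵥ β γ)))) α<a+b)
      (ℕₚ.≤⇒≯ (ℕₚ.+-mono-≤ (ℕₚ.≮⇒≥ β≮a) (ℕₚ.≮⇒≥ γ≮b)))

  order-^ₛ : ∀ {n} {A : PS n} a → Order≥ a A → ∀ k → Order≥ (k ℕ.* a) (A ^ₛ k)
  order-^ₛ a oA 0       α ()
  order-^ₛ a oA (suc k) = order-*ₛ a (k ℕ.* a) oA (order-^ₛ a oA k)

  order-prodPow : ∀ {m n} {Gs : Vec (PS n) m} → All (Order≥ 1) Gs →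
                  ∀ β → Order≥ (total β) (prodPow Gs β)
  order-prodPow []         []      α ()
  order-prodPow {Gs = G ∷ _} (oG ∷ oGs) (b ∷ β) = order-*ₛ b (total β)
    (≡.subst (λ k → Order≥ k (G ^ₛ b)) (ℕₚ.*-identityʳ b) (order-^ₛ 1 oG b)) (order-prodPow oGs β)

  -- Here the outer series changes too. Since the inner series have no constant term, its
  -- coefficients beyond degree D cannot reach degree D of the composite.
  ∘ₛ-cong-Total≤ : ∀ {m n} D {A A′ : PS m} {Gs Gs′ : Vec (PS n) m} →
    A ≈[ Total≤ D ] A′ → Pointwise _≈[ Total≤ D ]_ Gs Gs′ →
    All (Order≥ 1) Gs → All (Order≥ 1) Gs′ → (A ∘ₛ Gs) ≈[ Total≤ D ] (A′ ∘ₛ Gs′)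
  ∘ₛ-cong-Total≤ {m} D {A} {A′} {Gs} {Gs′} A≈ Gs≈ oGs oGs′ α α≤D =
    sumL-cong (box m (total α)) helper
    where
    helper : ∀ β → A β * prodPow Gs β α ≈ A′ β * prodPow Gs′ β α
    helper β with total β ℕ.≤? D
    ... | yes β≤D = *-cong (A≈ β β≤D) (prodPow-cong-on (closed-Total≤ D) Gs≈ β α α≤D)
    ... | no  β≰D = trans (vanish A oGs) (sym (vanish A′ oGs′))
      where
      vanish : ∀ (A : PS m) {Gs} → All (Order≥ 1) Gs → A β * prodPow Gs β α ≈ 0#
      vanish A oGs = trans (*-congˡ (order-prodPow oGs β α (ℕₚ.≤-<-trans α≤D (ℕₚ.≰⇒> β≰D))))
                           (zeroʳ (A β))

  -- The carrier remains `PS n` and only equality is coarsened, so that an equation in the quotient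
  -- can be read at any coefficient in `L`.
  quotient : ∀ {n} (L : Vec ℕ n → Set) → Closed L → CommutativeRing c ℓ
  quotient {n} L cl = record
    { Carrier = PS n
    ; _≈_     = _≈[ L ]_
    ; _+_     = _+ₛ_
    ; _*_     = _*ₛ_
    ; -_      = -ₛ_
    ; 0#      = zeroₛ
    ; 1#      = oneₛ
    ; isCommutativeRing = record
      { isRing = record
        { +-isAbelianGroup = record
          { isGroup = record
            { isMonoid = record
              { isSemigroup = record
                { isMagma = record
                  { isEquivalence = record
                    { refl  = λ α _ → refl
                    ; sym   = λ p α Lα → sym (p α Lα)
                    ; trans = λ p q α Lα → trans (p α Lα) (q α Lα)
                    }
                  ; ∙-cong = λ p q α Lα → +-cong (p α Lα) (q α Lα)
                  }
                ; assoc = λ A B C α _ → +-assoc (A α) (B α) (C α)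
                }
              ; identity = (λ A α _ → +-identityˡ (A α)) , (λ A α _ → +-identityʳ (A α))
              }
            ; inverse = (λ A α _ → -‿inverseˡ (A α)) , (λ A α _ → -‿inverseʳ (A α))
            ; ⁻¹-cong = λ p α Lα → -‿cong (p α Lα)
            }
          ; comm = λ A B α _ → +-comm (A α) (B α)
          }
        ; *-cong     = *ₛ-cong-on cl
        ; *-assoc    = λ A B C α _ → S.*-assoc A B C α
        ; *-identity = (λ A α _ → S.*-identityˡ A α) , (λ A α _ → S.*-identityʳ A α)
        ; distrib    = (λ A B C α _ → S.distribˡ A B C α) , (λ A B C α _ → S.distribʳ A B C α)
        }
      ; *-comm = λ A B α _ → S.*-comm A B α
      }
    }
    where module S = CommutativeRing (psRing n)

-- Evaluation of series in several variables along a ring homomorphism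

SemiringHom : ∀ {c ℓ : Level} (R S : CommutativeRing c ℓ) →
  (CommutativeRing.Carrier R → CommutativeRing.Carrier S) → Set _
SemiringHom R S = IsSemiringHomomorphism (rawSemiring R) (rawSemiring S)
  where
  rawSemiring : ∀ {c ℓ : Level} → CommutativeRing c ℓ → RawSemiring c ℓ
  rawSemiring = Semiring.rawSemiring ∘ CommutativeRing.semiring

module Evaluation {c ℓ : Level} (R S : CommutativeRing c ℓ)
  (ι : CommutativeRing.Carrier R → CommutativeRing.Carrier S) (ι-hom : SemiringHom R S ι) where
  private module R = CommutativeRing R
  open Series R using (PS; X; total; zeroₛ; _*ₛ_; _≋_)
  open Series S using (_^ᴿ_)
  open PowerSeries R using (slice; constₛ; _+ₛ_; *ₛ-slice; isCR; Σ-at; psRing;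
    X-vanish-lookup; X-vanish-total; lookup≤total)
  open Truncation R using (_≈[_]_; Total≤; closed-Total≤; quotient)
  open FiniteSum S
  open Convolution S
  open Horner S
  open Powers S using (^ᴿ-cong)
  open CommutativeRing S
  open IsSemiringHomomorphism ι-hom
  open import Relation.Binary.Reasoning.Setoid setoid

  -- Substitution truncated to exponents ≤ D; it is multiplicative once g ^ (D + 1) = 0 for each g,
  -- which holds for series without constant term modulo terms of total degree > D.
  evalₛ : ∀ {m} → ℕ → PS m → Vec Carrier m → Carrier
  evalₛ D A []       = ι (A [])
  evalₛ D A (g ∷ gs) = poly (suc D) g (λ k → evalₛ D (slice A k) gs)

  -- Each of the m exponents runs up to D, so no coefficient beyond total degree m * D is read.
  evalₛ-cong-on : ∀ {m} D {A B : PS m} gs → A ≈[ Total≤ (m ℕ.* D) ] B → evalₛ D A gs ≈ evalₛ D B gs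
  evalₛ-cong-on D []       A≈B = ⟦⟧-cong (A≈B [] z≤n)
  evalₛ-cong-on D (g ∷ gs) A≈B = poly-cong (suc D) g (λ k k≤D →
    evalₛ-cong-on D gs (λ α α≤ → A≈B (k ∷ α) (ℕₚ.+-mono-≤ (ℕₚ.≤-pred k≤D) α≤)))

  evalₛ-cong : ∀ {m} D {A B : PS m} gs → A ≋ B → evalₛ D A gs ≈ evalₛ D B gs
  evalₛ-cong D gs A≋B = evalₛ-cong-on D gs (λ α _ → A≋B α)

  evalₛ-congʳ : ∀ {m} D (A : PS m) {gs hs} → Pointwise _≈_ gs hs → evalₛ D A gs ≈ evalₛ D A hs
  evalₛ-congʳ D A []         = refl
  evalₛ-congʳ D A (g≈ ∷ gs≈) = Σ-cong (suc D) (λ k _ →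
    *-cong (^ᴿ-cong k g≈) (evalₛ-congʳ D (slice A k) gs≈))

  evalₛ-zero : ∀ {m} D gs → evalₛ {m} D zeroₛ gs ≈ 0#
  evalₛ-zero D []       = 0#-homo
  evalₛ-zero D (g ∷ gs) = Σ-zero (suc D) (λ k _ → trans (*-congˡ (evalₛ-zero D gs)) (zeroʳ (g ^ᴿ k)))

  poly-const : ∀ D g a → (∀ k → a (suc k) ≈ 0#) → poly (suc D) g a ≈ a 0
  poly-const D g a a≈0 = trans
    (+-cong (*-identityˡ _) (Σ-zero D (λ k _ → trans (*-congˡ (a≈0 k)) (zeroʳ _))))
    (+-identityʳ _)

  evalₛ-const : ∀ {m} D x gs → evalₛ {m} D (constₛ x) gs ≈ ι x
  evalₛ-const D x []       = refl
  evalₛ-const D x (g ∷ gs) = trans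
    (poly-const D g (λ k → evalₛ D (slice (constₛ x) k) gs) (λ k → evalₛ-zero D gs)) (evalₛ-const D x gs)

  evalₛ-+ : ∀ {m} D (A B : PS m) gs → evalₛ D (A +ₛ B) gs ≈ evalₛ D A gs + evalₛ D B gs
  evalₛ-+ D A B []       = +-homo (A []) (B [])
  evalₛ-+ D A B (g ∷ gs) = trans
    (poly-cong (suc D) g (λ k _ → evalₛ-+ D (slice A k) (slice B k) gs))
    (poly-+ (suc D) g (λ k → evalₛ D (slice A k) gs) (λ k → evalₛ D (slice B k) gs))

  evalₛ-Σ : ∀ {m} D n (F : ℕ → PS m) gs →
    evalₛ D (FiniteSum.Σ< (psRing m) n F) gs ≈ Σ< n (λ k → evalₛ D (F k) gs)
  evalₛ-Σ D 0       F gs = evalₛ-zero D gs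
  evalₛ-Σ D (suc n) F gs = trans (evalₛ-+ D (F 0) (FiniteSum.Σ< (psRing _) n (F ∘ suc)) gs)
    (+-congˡ (evalₛ-Σ D n (F ∘ suc) gs))

  evalₛ-* : ∀ {m} D (A B : PS m) {gs} → All (λ g → g ^ᴿ suc D ≈ 0#) gs →
            evalₛ D (A *ₛ B) gs ≈ evalₛ D A gs * evalₛ D B gs
  evalₛ-* D A B [] = trans (⟦⟧-cong (R.+-identityʳ _)) (*-homo (A []) (B []))
  evalₛ-* {suc m} D A B {g ∷ gs} (g⁰ ∷ gs⁰) = begin
    evalₛ D (A *ₛ B) (g ∷ gs)
      ≈⟨ poly-cong (suc D) g (λ k _ → slice-* k) ⟩
    poly (suc D) g (a ⋆ b)
      ≈⟨ poly-⋆ (suc D) g a b g⁰ ⟩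
    evalₛ D A (g ∷ gs) * evalₛ D B (g ∷ gs) ∎
    where
    a b : ℕ → Carrier
    a k = evalₛ D (slice A k) gs
    b k = evalₛ D (slice B k) gs

    slice-* : ∀ k → evalₛ D (slice (A *ₛ B) k) gs ≈ (a ⋆ b) k
    slice-* k = begin
      evalₛ D (slice (A *ₛ B) k) gs
        ≈⟨ evalₛ-cong D gs (λ α → R.trans (*ₛ-slice A B k α)
             (R.reflexive (≡.sym (Σ-at (isCR m) (suc k) term α)))) ⟩
      evalₛ D (FiniteSum.Σ< (psRing m) (suc k) term) gs
        ≈⟨ evalₛ-Σ D (suc k) term gs ⟩
      Σ< (suc k) (λ j → evalₛ D (term j) gs)
        ≈⟨ Σ-cong (suc k) (λ j _ → evalₛ-* D (slice A j) (slice B (k ∸ j)) gs⁰) ⟩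
      (a ⋆ b) k ∎
      where
      term : ℕ → PS m
      term j = slice A j *ₛ slice B (k ∸ j)

  -- The source is a truncated ring because in the associativity of composition the inner series are
  -- themselves known only up to a degree.
  evalₛ-hom : ∀ {m} D {D′ gs} → m ℕ.* D ≤ D′ → All (λ g → g ^ᴿ suc D ≈ 0#) gs →
              SemiringHom (quotient {m} (Total≤ D′) (closed-Total≤ D′)) S (λ A → evalₛ D A gs)
  evalₛ-hom D {gs = gs} mD≤D′ gs⁰ = record
    { isNearSemiringHomomorphism = record
      { +-isMonoidHomomorphism = record
        { isMagmaHomomorphism = record
          { isRelHomomorphism = record { cong = λ A≈B →
              evalₛ-cong-on D gs (λ α α≤ → A≈B α (ℕₚ.≤-trans α≤ mD≤D′)) }
          ; homo = λ A B → evalₛ-+ D A B gs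
          }
        ; ε-homo = evalₛ-zero D gs
        }
      ; *-homo = λ A B → evalₛ-* D A B gs⁰
      }
    ; 1#-homo = trans (evalₛ-const D R.1# gs) 1#-homo
    }

  -- The bound is a successor because a cut at exponent 0 would lose the linear term.
  evalₛ-X : ∀ {m} D (i : Fin m) gs → evalₛ (suc D) (X i) gs ≈ lookup gs i
  evalₛ-X {suc m} D Fin.zero (g ∷ gs) = begin
    poly (suc (suc D)) g a
      ≈⟨ poly-suc (suc D) g a ⟩
    a 0 + g * poly (suc D) g (a ∘ suc)
      ≈⟨ +-cong (evalₛ-zero (suc D) gs)
                (*-congˡ (poly-const D g (a ∘ suc) (λ k → evalₛ-zero (suc D) gs))) ⟩
    0# + g * a 1
      ≈⟨ +-identityˡ _ ⟩
    g * a 1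
      ≈⟨ *-congˡ (trans (evalₛ-const (suc D) R.1# gs) 1#-homo) ⟩
    g * 1#
      ≈⟨ *-identityʳ g ⟩
    g ∎
    where
    a : ℕ → Carrier
    a k = evalₛ (suc D) (slice (X (Fin.zero {m})) k) gs
  evalₛ-X D (Fin.suc i) (g ∷ gs) = trans
    (poly-const (suc D) g (λ k → evalₛ (suc D) (slice (X (Fin.suc i)) k) gs)
      (λ k → trans (evalₛ-cong (suc D) gs (slice≋0 k)) (evalₛ-zero (suc D) gs)))
    (evalₛ-X D i gs)
    where
    slice≋0 : ∀ k → slice (X (Fin.suc i)) (suc k) ≋ zeroₛ
    slice≋0 k α with total α ℕ.≟ 0
    ... | yes α≡0 = R.reflexive (X-vanish-lookup (Fin.suc i) (suc k ∷ α) λ α≡1 →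
      ℕₚ.<-irrefl ≡.refl (≡.subst₂ _≤_ α≡1 α≡0 (lookup≤total i α)))
    ... | no  α≢0 = R.reflexive (X-vanish-total (Fin.suc i) (suc k ∷ α) λ α≡1 →
      α≢0 (ℕₚ.m+n≡0⇒n≡0 k (ℕₚ.suc-injective α≡1)))

-- Naturality of evaluation

module _ {c ℓ : Level} (R S T : CommutativeRing c ℓ) where
  private
    module S = CommutativeRing S
    module T = CommutativeRing T
  open Series R using (PS)

  module _ {ι : CommutativeRing.Carrier R → S.Carrier} {κ : CommutativeRing.Carrier R → T.Carrier}
           {θ : S.Carrier → T.Carrier} (ι-hom : SemiringHom R S ι) (κ-hom : SemiringHom R T κ)
           (θ-hom : SemiringHom S T θ) (θι≈κ : ∀ x → θ (ι x) T.≈ κ x) where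
    open IsSemiringHomomorphism θ-hom
    open Series S using () renaming (_^ᴿ_ to _^S_)
    open Series T using () renaming (_^ᴿ_ to _^T_)
    open Evaluation R S ι ι-hom using () renaming (evalₛ to evalS)
    open Evaluation R T κ κ-hom using () renaming (evalₛ to evalT)
    open FiniteSum S using () renaming (Σ< to ΣS<)
    open FiniteSum T using () renaming (Σ< to ΣT<; Σ-cong to ΣT-cong)

    ^-homo : ∀ x k → θ (x ^S k) T.≈ (θ x ^T k)
    ^-homo x 0       = 1#-homo
    ^-homo x (suc k) = T.trans (*-homo _ _) (T.*-congˡ (^-homo x k))

    Σ-homo : ∀ n f → θ (ΣS< n f) T.≈ ΣT< n (θ ∘ f)
    Σ-homo 0       f = 0#-homo
    Σ-homo (suc n) f = T.trans (+-homo _ _) (T.+-congˡ (Σ-homo n (f ∘ suc)))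

    evalₛ-natural : ∀ {m} D (A : PS m) gs → θ (evalS D A gs) T.≈ evalT D A (Vec.map θ gs)
    evalₛ-natural D A []       = θι≈κ (A [])
    evalₛ-natural D A (g ∷ gs) = T.trans
      (Σ-homo (suc D) (λ k → (g ^S k) S.* evalS D (λ α → A (k ∷ α)) gs))
      (ΣT-cong (suc D) (λ k _ → T.trans (*-homo _ _)
        (T.*-cong (^-homo g k) (evalₛ-natural D (λ α → A (k ∷ α)) gs))))

-- Laws of composition

module Composition {c ℓ : Level} (R : CommutativeRing c ℓ) where
  open CommutativeRing R
  open Series R
  open PowerSeries R
  open Truncation R
  open FiniteSum R
  open import Relation.Binary.Reasoning.Setoid setoid

  Q : ℕ → ℕ → CommutativeRing c ℓ
  Q n D = quotient {n} (Total≤ D) (closed-Total≤ D)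

  constₛ-hom : ∀ n D → SemiringHom R (Q n D) constₛ
  constₛ-hom n D = record
    { isNearSemiringHomomorphism = record
      { +-isMonoidHomomorphism = record
        { isMagmaHomomorphism = record
          { isRelHomomorphism = record { cong = λ x≈y α _ → constₛ-cong x≈y α }
          ; homo = λ x y α _ → constₛ-+ x y α
          }
        ; ε-homo = λ α _ → constₛ-zero α
        }
      ; *-homo = λ x y α _ → constₛ-* x y α
      }
    ; 1#-homo = λ α _ → refl
    }

  module Ev (n D : ℕ) = Evaluation R (Q n D) constₛ (constₛ-hom n D)

  module _ {n D : ℕ} where
    private module Q′ = CommutativeRing (Q n D)
    open FiniteSum (Q n D) using ()
      renaming (Σ< to ΣQ<; Σ-cong to ΣQ-cong; Σbox to ΣQbox; Σbox-*ˡ to ΣQbox-*ˡ; Σbox-cong to ΣQbox-cong)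
    open Series (Q n D) using () renaming (_^ᴿ_ to _^Q_)
    open import Algebra.Properties.CommutativeSemigroup Q′.*-commutativeSemigroup
      using (x∙yz≈y∙xz)

    ^Q≡^ₛ : ∀ (A : PS n) k → A ^Q k ≡ A ^ₛ k
    ^Q≡^ₛ A 0       = ≡.refl
    ^Q≡^ₛ A (suc k) = ≡.cong (A *ₛ_) (^Q≡^ₛ A k)

    nilpotent : ∀ {m} {Gs : Vec (PS n) m} → All (Order≥ 1) Gs → All (λ G → G ^Q suc D Q′.≈ zeroₛ) Gs
    nilpotent []               = []
    nilpotent {Gs = G ∷ _} (oG ∷ oGs) = (λ α α≤D → trans
      (reflexive (≡.cong (λ A → A α) (^Q≡^ₛ G (suc D))))
      (order-^ₛ 1 oG (suc D) α (s≤s (ℕₚ.≤-trans α≤D (ℕₚ.≤-reflexive (≡.sym (ℕₚ.*-identityʳ D)))))))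
      ∷ nilpotent oGs

    ΣQ-at : ∀ k f α → ΣQ< k f α ≡ Σ< k (λ j → f j α)
    ΣQ-at 0       f α = ≡.refl
    ΣQ-at (suc k) f α = ≡.cong (f 0 α +_) (ΣQ-at k (f ∘ suc) α)

    ΣQbox-at : ∀ m d f α → ΣQbox m d f α ≈ Σbox m d (λ β → f β α)
    ΣQbox-at 0       d f α = refl
    ΣQbox-at (suc m) d f α = trans (reflexive (ΣQ-at (suc d) (λ k → ΣQbox m d (λ β → f (k ∷ β))) α))
      (Σ-cong (suc d) (λ k _ → ΣQbox-at m d (λ β → f (k ∷ β)) α))

    evalₛ-box : ∀ {m} d (A : PS m) Gs →
      Ev.evalₛ n D d A Gs Q′.≈ ΣQbox m d (λ β → constₛ (A β) *ₛ prodPow Gs β)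
    evalₛ-box d A []       = Q′.sym (Q′.*-identityʳ (constₛ (A [])))
    evalₛ-box d A (G ∷ Gs) = ΣQ-cong (suc d) λ k _ → Q′.trans
      (Q′.*-cong (Q′.reflexive (^Q≡^ₛ G k)) (evalₛ-box d (slice A k) Gs)) (Q′.trans
      (ΣQbox-*ˡ _ d (G ^ₛ k) (λ β → constₛ (A (k ∷ β)) *ₛ prodPow Gs β))
      (ΣQbox-cong _ d (λ β → x∙yz≈y∙xz (G ^ₛ k) (constₛ (A (k ∷ β))) (prodPow Gs β))))

    -- Without constant terms in `Gs`, exponents beyond the degree contribute zero, so every cut d ≥
    -- D gives the same result. The freedom in `d` serves `∘ₛ-assoc`, where outer and inner
    -- evaluation have different cuts.
    ∘ₛ-evalₛ : ∀ {m d} (A : PS m) {Gs : Vec (PS n) m} → All (Order≥ 1) Gs → D ≤ d →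
               (A ∘ₛ Gs) Q′.≈ Ev.evalₛ n D d A Gs
    ∘ₛ-evalₛ {m} {d} A {Gs} oGs D≤d α α≤D = begin
      (A ∘ₛ Gs) α
        ≈⟨ sumL-box m (total α) _ ⟩
      Σbox m (total α) (λ β → A β * prodPow Gs β α)
        ≈⟨ Σbox-extend m (ℕₚ.≤-trans α≤D D≤d)
             (λ β α<β → trans (*-congˡ (order-prodPow oGs β α α<β)) (zeroʳ (A β))) ⟩
      Σbox m d (λ β → A β * prodPow Gs β α)
        ≈⟨ Σbox-cong m d (λ β → constₛ-*ₛ (A β) (prodPow Gs β) α) ⟨
      Σbox m d (λ β → (constₛ (A β) *ₛ prodPow Gs β) α)
        ≈⟨ ΣQbox-at m d (λ β → constₛ (A β) *ₛ prodPow Gs β) α ⟨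
      ΣQbox m d (λ β → constₛ (A β) *ₛ prodPow Gs β) α
        ≈⟨ evalₛ-box d A Gs α α≤D ⟨
      Ev.evalₛ n D d A Gs α ∎

  order-∘ₛ : ∀ {m n} {A : PS m} {Gs : Vec (PS n) m} →
             Order≥ 1 A → All (Order≥ 1) Gs → Order≥ 1 (A ∘ₛ Gs)
  order-∘ₛ {m} {A = A} {Gs} oA oGs α α<1 = trans (sumL-box m (total α) _)
    (Σbox-zero m (total α) helper)
    where
    helper : ∀ β → A β * prodPow Gs β α ≈ 0#
    helper β with total β ℕ.<? 1
    ... | yes β<1 = trans (*-congʳ (oA β β<1)) (zeroˡ _)
    ... | no  β≮1 = trans (*-congˡ (order-prodPow oGs β α (ℕₚ.<-≤-trans α<1 (ℕₚ.≮⇒≥ β≮1)))) (zeroʳ _)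

  orders-∘ₛ : ∀ {k m n} {Gs : Vec (PS m) k} {Hs : Vec (PS n) m} →
    All (Order≥ 1) Gs → All (Order≥ 1) Hs → All (Order≥ 1) (Vec.map (_∘ₛ Hs) Gs)
  orders-∘ₛ []         oHs = []
  orders-∘ₛ (oG ∷ oGs) oHs = order-∘ₛ oG oHs ∷ orders-∘ₛ oGs oHs

  -- Up to degree D, substituting `Hs` is a ring homomorphism `θ` that fixes constants, so it sends
  -- the value of `A` at `Gs` to its value at the images of `Gs`.
  ∘ₛ-assoc : ∀ {k m n} (A : PS k) {Gs : Vec (PS m) k} {Hs : Vec (PS n) m} →
    All (Order≥ 1) Gs → All (Order≥ 1) Hs →
    ((A ∘ₛ Gs) ∘ₛ Hs) ≋ (A ∘ₛ Vec.map (_∘ₛ Hs) Gs)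
  ∘ₛ-assoc {k} {m} {n} A {Gs} {Hs} oGs oHs α = chain α ℕₚ.≤-refl
    where
    D E : ℕ
    D = total α
    -- Evaluation at the m series `Hs` with cut D reads `A ∘ₛ Gs` up to degree m * D. The summand D
    -- ensures E ≥ D, as the last conversion back to `_∘ₛ_` requires.
    E = D ℕ.+ m ℕ.* D
    module T = CommutativeRing (Q n D)
    module EvT = Ev n D
    θ : PS m → PS n
    θ G = EvT.evalₛ D G Hs

    θ-pointwise : ∀ {k} (Gs : Vec (PS m) k) →
                  Pointwise T._≈_ (Vec.map θ Gs) (Vec.map (_∘ₛ Hs) Gs)
    θ-pointwise []       = []
    θ-pointwise (G ∷ Gs) = T.sym {G ∘ₛ Hs} {θ G} (∘ₛ-evalₛ G oHs ℕₚ.≤-refl) ∷ θ-pointwise Gs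

    chain : ((A ∘ₛ Gs) ∘ₛ Hs) T.≈ (A ∘ₛ Vec.map (_∘ₛ Hs) Gs)
    chain = T.trans (∘ₛ-evalₛ (A ∘ₛ Gs) oHs ℕₚ.≤-refl)
      (T.trans (EvT.evalₛ-cong-on D Hs (λ β β≤ →
        ∘ₛ-evalₛ {D = E} A oGs ℕₚ.≤-refl β (ℕₚ.≤-trans β≤ (ℕₚ.m≤n+m _ D))))
      (T.trans (evalₛ-natural R (Q m E) (Q n D) (constₛ-hom m E) (constₛ-hom n D)
        (EvT.evalₛ-hom D (ℕₚ.m≤n+m _ D) (nilpotent oHs)) (λ x → EvT.evalₛ-const D x Hs) E A Gs)
      (T.trans (EvT.evalₛ-congʳ E A (θ-pointwise Gs))
      (T.sym {A ∘ₛ Vec.map (_∘ₛ Hs) Gs} (∘ₛ-evalₛ A (orders-∘ₛ oGs oHs) (ℕₚ.m≤m+n D _))))))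

  X-∘ₛ : ∀ {m n} (i : Fin m) {Gs : Vec (PS n) m} → All (Order≥ 1) Gs → (X i ∘ₛ Gs) ≋ lookup Gs i
  X-∘ₛ i {Gs} oGs α = trans (∘ₛ-evalₛ {D = total α} (X i) oGs (ℕₚ.n≤1+n _) α ℕₚ.≤-refl)
    (Ev.evalₛ-X _ (total α) (total α) i Gs α ℕₚ.≤-refl)

-- Frobenius on power series

module Frobenius {c ℓ : Level} (R : CommutativeRing c ℓ) where
  open CommutativeRing R
  open Series R
  open PowerSeries R
  open FiniteSum R
  open import Relation.Binary.Reasoning.Setoid setoid
  private module P {n : ℕ} = CommutativeRing (psRing n)
  private module Pow {n : ℕ} = Powers (psRing n)

  ^ₛ≡^ᴿ : ∀ {n} (A : PS n) k → A ^ₛ k ≡ Series._^ᴿ_ (psRing n) A k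
  ^ₛ≡^ᴿ A 0       = ≡.refl
  ^ₛ≡^ᴿ A (suc k) = ≡.cong (A *ₛ_) (^ₛ≡^ᴿ A k)

  ^ₛ-assoc : ∀ {n} (A : PS n) k l → ((A ^ₛ k) ^ₛ l) ≋ (A ^ₛ (k ℕ.* l))
  ^ₛ-assoc A k l rewrite ^ₛ≡^ᴿ A k | ^ₛ≡^ᴿ (Series._^ᴿ_ (psRing _) A k) l | ^ₛ≡^ᴿ A (k ℕ.* l) =
    Pow.^ᴿ-assoc A k l

  ^ₛ-cong : ∀ {n} {A B : PS n} k → A ≋ B → (A ^ₛ k) ≋ (B ^ₛ k)
  ^ₛ-cong 0       A≋B α = refl
  ^ₛ-cong (suc k) A≋B   = *ₛ-cong A≋B (^ₛ-cong k A≋B)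

  ^ₛ-distrib-*ₛ : ∀ {n} (A B : PS n) k → ((A *ₛ B) ^ₛ k) ≋ ((A ^ₛ k) *ₛ (B ^ₛ k))
  ^ₛ-distrib-*ₛ A B k rewrite ^ₛ≡^ᴿ (A *ₛ B) k | ^ₛ≡^ᴿ A k | ^ₛ≡^ᴿ B k = Pow.^ᴿ-distrib-* A B k

  natR-psRing : ∀ {n} k α → Series.natR (psRing n) k α ≈ natR k * oneₛ α
  natR-psRing 0       α = sym (zeroˡ _)
  natR-psRing (suc k) α = trans (+-cong (sym (*-identityˡ _)) (natR-psRing k α))
                                (sym (distribʳ _ 1# (natR k)))

  frobeniusₛ-+ : ∀ {n p} → natR p ≈ 0# → Prime p → (A B : PS n) →
                 ((A +ₛ B) ^ₛ p) ≋ ((A ^ₛ p) +ₛ (B ^ₛ p))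
  frobeniusₛ-+ {p = p} char pp A B rewrite ^ₛ≡^ᴿ (A +ₛ B) p | ^ₛ≡^ᴿ A p | ^ₛ≡^ᴿ B p =
    Pow.frobenius-+ (λ α → trans (natR-psRing p α) (trans (*-congʳ char) (zeroˡ _))) pp A B

  X₀ : ∀ {n} → PS (suc n)
  X₀ = X Fin.zero

  X₀-*ₛ-zero : ∀ {n} (A : PS (suc n)) α → (X₀ *ₛ A) (0 ∷ α) ≈ 0#
  X₀-*ₛ-zero A α = trans (*ₛ-slice X₀ A 0 α) (trans (+-identityʳ _) (*ₛ-zeroˡ (slice A 0) α))

  X₀-*ₛ-suc : ∀ {n} (A : PS (suc n)) a α → (X₀ *ₛ A) (suc a ∷ α) ≈ A (a ∷ α)
  X₀-*ₛ-suc A a α = begin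
    (X₀ *ₛ A) (suc a ∷ α)
      ≈⟨ *ₛ-slice X₀ A (suc a) α ⟩
    (zeroₛ *ₛ slice A (suc a)) α + ((oneₛ *ₛ slice A a) α + Σ< a (λ k → (zeroₛ *ₛ slice A (a ∸ suc k)) α))
      ≈⟨ +-cong (*ₛ-zeroˡ (slice A (suc a)) α)
           (+-cong (P.*-identityˡ (slice A a) α) (Σ-zero a (λ k _ → *ₛ-zeroˡ (slice A (a ∸ suc k)) α))) ⟩
    0# + (A (a ∷ α) + 0#)
      ≈⟨ trans (+-identityˡ _) (+-identityʳ _) ⟩
    A (a ∷ α) ∎

  X₀^-*ₛ : ∀ {n} (A : PS (suc n)) k a α → ((X₀ ^ₛ k) *ₛ A) (k ℕ.+ a ∷ α) ≈ A (a ∷ α)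
  X₀^-*ₛ A 0       a α = P.*-identityˡ A (a ∷ α)
  X₀^-*ₛ A (suc k) a α = trans (P.*-assoc X₀ (X₀ ^ₛ k) A (suc (k ℕ.+ a) ∷ α))
    (trans (X₀-*ₛ-suc ((X₀ ^ₛ k) *ₛ A) (k ℕ.+ a) α) (X₀^-*ₛ A k a α))

  X₀^-*ₛ-< : ∀ {n} (A : PS (suc n)) k a α → a < k → ((X₀ ^ₛ k) *ₛ A) (a ∷ α) ≈ 0#
  X₀^-*ₛ-< A (suc k) 0       α a<k = trans (P.*-assoc X₀ (X₀ ^ₛ k) A (0 ∷ α))
    (X₀-*ₛ-zero ((X₀ ^ₛ k) *ₛ A) α)
  X₀^-*ₛ-< A (suc k) (suc a) α a<k = trans (P.*-assoc X₀ (X₀ ^ₛ k) A (suc a ∷ α))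
    (trans (X₀-*ₛ-suc ((X₀ ^ₛ k) *ₛ A) a α) (X₀^-*ₛ-< A k a α (ℕₚ.≤-pred a<k)))

  X₀^-diag : ∀ {n} k (α : Vec ℕ n) → (X₀ ^ₛ k) (k ∷ α) ≈ oneₛ α
  X₀^-diag k α = trans (sym (P.*-identityʳ (X₀ ^ₛ k) (k ∷ α)))
    (≡.subst (λ l → ((X₀ ^ₛ k) *ₛ oneₛ) (l ∷ α) ≈ oneₛ α) (ℕₚ.+-identityʳ k) (X₀^-*ₛ oneₛ k 0 α))

  X₀^-offdiag : ∀ {n} k a (α : Vec ℕ n) → k ≢ a → (X₀ ^ₛ k) (a ∷ α) ≈ 0#
  X₀^-offdiag k a α k≢a with ℕₚ.<-cmp k a
  ... | tri≈ _ k≡a _ = contradiction k≡a k≢a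
  ... | tri> _ _ a<k = trans (sym (P.*-identityʳ (X₀ ^ₛ k) (a ∷ α))) (X₀^-*ₛ-< oneₛ k a α a<k)
  ... | tri< k<a _ _ with ℕₚ.m≤n⇒∃[o]m+o≡n k<a
  ...   | o , ≡.refl = trans (sym (P.*-identityʳ (X₀ ^ₛ k) (suc (k ℕ.+ o) ∷ α)))
    (≡.subst (λ l → ((X₀ ^ₛ k) *ₛ oneₛ) (l ∷ α) ≈ 0#) (ℕₚ.+-suc k o) (X₀^-*ₛ oneₛ k (suc o) α))

  embed : ∀ {n} → PS n → PS (suc n)
  embed A (0     ∷ α) = A α
  embed A (suc _ ∷ α) = 0#

  tail : ∀ {n} → PS (suc n) → PS (suc n)
  tail A (a ∷ α) = A (suc a ∷ α)

  embed-*ₛ : ∀ {n} (A : PS n) B a α → (embed A *ₛ B) (a ∷ α) ≈ (A *ₛ slice B a) α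
  embed-*ₛ A B a α = trans (*ₛ-slice (embed A) B a α)
    (trans (+-congˡ (Σ-zero a (λ k _ → *ₛ-zeroˡ (slice B (a ∸ suc k)) α))) (+-identityʳ _))

  embed-^ₛ : ∀ {n} (A : PS n) k → (embed A ^ₛ k) ≋ embed (A ^ₛ k)
  embed-^ₛ A 0       (0 ∷ α)     = refl
  embed-^ₛ A 0       (suc a ∷ α) = refl
  embed-^ₛ A (suc k) (a ∷ α)     = trans (embed-*ₛ A (embed A ^ₛ k) a α)
    (trans (*ₛ-cong {A = A} (λ _ → refl) (λ β → embed-^ₛ A k (a ∷ β)) α) (helper a))
    where
    helper : ∀ a → (A *ₛ slice (embed (A ^ₛ k)) a) α ≈ embed (A ^ₛ suc k) (a ∷ α)
    helper 0       = refl
    helper (suc a) = P.zeroʳ A α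

  embed+X₀*tail : ∀ {n} (A : PS (suc n)) → A ≋ (embed (slice A 0) +ₛ (X₀ *ₛ tail A))
  embed+X₀*tail A (0 ∷ α)     = sym (trans (+-congˡ (X₀-*ₛ-zero (tail A) α)) (+-identityʳ _))
  embed+X₀*tail A (suc a ∷ α) = sym (trans (+-congˡ (X₀-*ₛ-suc (tail A) a α)) (+-identityˡ _))

  infixr 8 _·ᵥ_
  _·ᵥ_ : ∀ {n} → ℕ → Vec ℕ n → Vec ℕ n
  k ·ᵥ α = Vec.map (k ℕ.*_) α

  ·ᵥ-assoc : ∀ {n} k l (α : Vec ℕ n) → (k ℕ.* l) ·ᵥ α ≡ k ·ᵥ l ·ᵥ α
  ·ᵥ-assoc k l []      = ≡.refl
  ·ᵥ-assoc k l (a ∷ α) = ≡.cong₂ _∷_ (ℕₚ.*-assoc k l a) (·ᵥ-assoc k l α)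

  ^ₛ-scalar : ∀ (A : PS 0) k → (A ^ₛ k) [] ≈ A [] ^ᴿ k
  ^ₛ-scalar A 0       = refl
  ^ₛ-scalar A (suc k) = trans (+-identityʳ _) (*-congˡ (^ₛ-scalar A k))

  module _ {p : ℕ} (char : natR p ≈ 0#) (pp : Prime p) where
    private
      0<p : 0 < p
      0<p = ℕ.>-nonZero⁻¹ p {{prime⇒nonZero pp}}

    -- Write A = A₀ + X₀ A₁, where A₀ does not involve X₀. The p-th power respects sum and product,
    -- and X₀ ^ p shifts the first exponent by p, so passing from a + 1 to a replaces A by A₁ =
    -- `tail A`.
    frobenius-slice : ∀ {n} (A : PS (suc n)) a β →
                      (A ^ₛ p) (p ℕ.* a ∷ β) ≈ (slice A a ^ₛ p) β
    frobenius-slice A a β = trans (expand (p ℕ.* a ∷ β)) (cases a)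
      where
      expand : (A ^ₛ p) ≋ (embed (slice A 0 ^ₛ p) +ₛ ((X₀ ^ₛ p) *ₛ (tail A ^ₛ p)))
      expand α = trans (^ₛ-cong p (embed+X₀*tail A) α)
        (trans (frobeniusₛ-+ char pp (embed (slice A 0)) (X₀ *ₛ tail A) α)
        (+-cong (embed-^ₛ (slice A 0) p α) (^ₛ-distrib-*ₛ X₀ (tail A) p α)))

      cases : ∀ a → (embed (slice A 0 ^ₛ p) +ₛ ((X₀ ^ₛ p) *ₛ (tail A ^ₛ p))) (p ℕ.* a ∷ β) ≈
                    (slice A a ^ₛ p) β
      cases 0 rewrite ℕₚ.*-zeroʳ p =
        trans (+-congˡ (X₀^-*ₛ-< (tail A ^ₛ p) p 0 β 0<p)) (+-identityʳ _)
      cases (suc a) rewrite ℕₚ.*-suc p a = trans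
        (+-cong (embed-zero 0<p) (trans (X₀^-*ₛ (tail A ^ₛ p) p (p ℕ.* a) β) (frobenius-slice (tail A) a β)))
        (+-identityˡ _)
        where
        embed-zero : ∀ {B k l} → 0 < k → embed B (k ℕ.+ l ∷ β) ≈ 0#
        embed-zero {k = suc k} _ = refl

    frobenius-coeff : ∀ {n} (A : PS n) α → (A ^ₛ p) (p ·ᵥ α) ≈ A α ^ᴿ p
    frobenius-coeff A []      = ^ₛ-scalar A p
    frobenius-coeff A (a ∷ α) = trans (frobenius-slice A a (p ·ᵥ α)) (frobenius-coeff (slice A a) α)

    frobenius-iter : ∀ {n} h (A : PS n) α → (A ^ₛ (p ^ h)) ((p ^ h) ·ᵥ α) ≈ A α ^ᴿ (p ^ h)
    frobenius-iter 0       A α = trans (P.*-identityʳ A (1 ·ᵥ α))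
      (trans (reflexive (≡.cong A (1·ᵥ α))) (sym (*-identityʳ _)))
      where
      1·ᵥ : ∀ {n} (α : Vec ℕ n) → 1 ·ᵥ α ≡ α
      1·ᵥ []      = ≡.refl
      1·ᵥ (a ∷ α) = ≡.cong₂ _∷_ (ℕₚ.*-identityˡ a) (1·ᵥ α)
    frobenius-iter (suc h) A α = begin
      (A ^ₛ (p ℕ.* p ^ h)) ((p ℕ.* p ^ h) ·ᵥ α)
        ≈⟨ ^ₛ-assoc A p (p ^ h) ((p ℕ.* p ^ h) ·ᵥ α) ⟨
      ((A ^ₛ p) ^ₛ (p ^ h)) ((p ℕ.* p ^ h) ·ᵥ α)
        ≡⟨ ≡.cong ((A ^ₛ p) ^ₛ (p ^ h)) (≡.trans (≡.cong (_·ᵥ α) (ℕₚ.*-comm p (p ^ h))) (·ᵥ-assoc (p ^ h) p α)) ⟩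
      ((A ^ₛ p) ^ₛ (p ^ h)) ((p ^ h) ·ᵥ p ·ᵥ α)
        ≈⟨ frobenius-iter h (A ^ₛ p) (p ·ᵥ α) ⟩
      ((A ^ₛ p) (p ·ᵥ α)) ^ᴿ (p ^ h)
        ≈⟨ Powers.^ᴿ-cong R (p ^ h) (frobenius-coeff A α) ⟩
      (A α ^ᴿ p) ^ᴿ (p ^ h)
        ≈⟨ Powers.^ᴿ-assoc R (A α) p (p ^ h) ⟩
      A α ^ᴿ (p ℕ.* p ^ h) ∎

-- Arithmetic of a formal group law and its homomorphisms

module FormalGroup {c ℓ : Level} (R : CommutativeRing c ℓ) where
  open CommutativeRing R
  open Series R
  open PowerSeries R
  open Truncation R
  open Composition R
  open Frobenius R
  open FiniteSum R
  open import Algebra.Bundles using (CommutativeSemigroup)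
  open import Relation.Binary.Reasoning.Setoid setoid

  ∘ₛ-congˡ : ∀ {m n} {A A′ : PS m} (Gs : Vec (PS n) m) → A ≋ A′ → (A ∘ₛ Gs) ≋ (A′ ∘ₛ Gs)
  ∘ₛ-congˡ {m} Gs A≋A′ α = sumL-cong (box m (total α)) (λ β → *-congʳ (A≋A′ β))

  ∘ₛ-congʳ : ∀ {m n} (A : PS m) {Gs Gs′ : Vec (PS n) m} → Pointwise _≋_ Gs Gs′ →
             (A ∘ₛ Gs) ≋ (A ∘ₛ Gs′)
  ∘ₛ-congʳ A Gs≋ α = ∘ₛ-cong-on {L = λ _ → ⊤} (λ _ _ _ → tt , tt) A (weaken Gs≋) α tt
    where
    weaken : ∀ {m n} {Gs Gs′ : Vec (PS n) m} → Pointwise _≋_ Gs Gs′ →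
             Pointwise _≈[ (λ _ → ⊤) ]_ Gs Gs′
    weaken []         = []
    weaken (G≋ ∷ Gs≋) = (λ α _ → G≋ α) ∷ weaken Gs≋

  order-X : ∀ {n} (i : Fin n) → Order≥ 1 (X i)
  order-X i α α<1 = reflexive (X-vanish-total i α (ℕₚ.<⇒≢ α<1))

  order-zeroₛ : ∀ {n} → Order≥ 1 (zeroₛ {n})
  order-zeroₛ α _ = refl

  ∘ₛ-Σ : ∀ {n} (A : PS 1) (G : PS n) α {d} → total α ≡ d →
         (A ∘ₛ (G ∷ [])) α ≈ Σ< (suc d) (λ k → coeff₁ A k * (G ^ₛ k) α)
  ∘ₛ-Σ A G α ≡.refl = trans (sumL-box 1 (total α) _)
    (Σ-cong (suc (total α)) (λ k _ → *-congˡ {coeff₁ A k} (*ₛ-identityʳ (G ^ₛ k) α)))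

  total₁ : ∀ a → total (a ∷ []) ≡ a
  total₁ = ℕₚ.+-identityʳ

  Σ-*-τ^ : ∀ (g : ℕ → Carrier) a → Σ< (suc a) (λ k → g k * (τ ^ₛ k) (a ∷ [])) ≈ g a
  Σ-*-τ^ g a = trans
    (Σ-single {f = λ k → g k * (τ ^ₛ k) (a ∷ [])} a (ℕₚ.n<1+n a) (λ k _ k≢a →
      trans (*-congˡ (X₀^-offdiag k a [] k≢a)) (zeroʳ (g k))))
    (trans (*-congˡ (X₀^-diag a [])) (*-identityʳ (g a)))

  ∘ₛ-τ : ∀ (A : PS 1) → (A ∘ₛ (τ ∷ [])) ≋ A
  ∘ₛ-τ A (a ∷ []) = trans (∘ₛ-Σ A τ (a ∷ []) (total₁ a)) (Σ-*-τ^ (coeff₁ A) a)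

  zeroₛ-^ₛ : ∀ {n} k → (zeroₛ {n} ^ₛ suc k) ≋ zeroₛ
  zeroₛ-^ₛ k = *ₛ-zeroˡ (zeroₛ ^ₛ k)

  private
    ∘ₛ-Σ₂ : ∀ (F : PS 2) (G H : PS 1) a → (F ∘ₛ (G ∷ H ∷ [])) (a ∷ []) ≈
      Σ< (suc a) (λ k → Σ< (suc a) (λ l → coeff₂ F k l * ((G ^ₛ k) *ₛ (H ^ₛ l)) (a ∷ [])))
    ∘ₛ-Σ₂ F G H a = begin
      (F ∘ₛ (G ∷ H ∷ [])) (a ∷ [])
        ≈⟨ sumL-box 2 (total (a ∷ [])) _ ⟩
      Σbox 2 (total (a ∷ [])) (λ β → F β * prodPow (G ∷ H ∷ []) β (a ∷ []))
        ≡⟨ ≡.cong (λ d → Σbox 2 d (λ β → F β * prodPow (G ∷ H ∷ []) β (a ∷ []))) (total₁ a) ⟩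
      Σ< (suc a) (λ k → Σ< (suc a) (λ l → coeff₂ F k l * prodPow (G ∷ H ∷ []) (k ∷ l ∷ []) (a ∷ [])))
        ≈⟨ Σ-cong (suc a) (λ k _ → Σ-cong (suc a) (λ l _ → *-congˡ {coeff₂ F k l}
             (*ₛ-cong {A = G ^ₛ k} ≋-refl (*ₛ-identityʳ (H ^ₛ l)) (a ∷ [])))) ⟩
      Σ< (suc a) (λ k → Σ< (suc a) (λ l → coeff₂ F k l * ((G ^ₛ k) *ₛ (H ^ₛ l)) (a ∷ []))) ∎

  ∘ₛ-τ-zeroₛ : ∀ (F : PS 2) a → (F ∘ₛ (τ ∷ zeroₛ ∷ [])) (a ∷ []) ≈ coeff₂ F a 0
  ∘ₛ-τ-zeroₛ F a = begin
    (F ∘ₛ (τ ∷ zeroₛ ∷ [])) (a ∷ [])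
      ≈⟨ ∘ₛ-Σ₂ F τ zeroₛ a ⟩
    Σ< (suc a) (λ k → Σ< (suc a) (term k))
      ≈⟨ Σ-cong (suc a) (λ k _ → trans (Σ-single {f = term k} 0 (s≤s z≤n) (off k))
           (*-congˡ {coeff₂ F k 0} (*ₛ-identityʳ (τ ^ₛ k) (a ∷ [])))) ⟩
    Σ< (suc a) (λ k → coeff₂ F k 0 * (τ ^ₛ k) (a ∷ []))
      ≈⟨ Σ-*-τ^ (λ k → coeff₂ F k 0) a ⟩
    coeff₂ F a 0 ∎
    where
    term : ℕ → ℕ → Carrier
    term k l = coeff₂ F k l * ((τ ^ₛ k) *ₛ (zeroₛ ^ₛ l)) (a ∷ [])

    off : ∀ k l → l < suc a → l ≢ 0 → term k l ≈ 0#
    off k 0       _ 0≢0 = contradiction ≡.refl 0≢0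
    off k (suc l) _ _   = trans (*-congˡ (≋-trans (*ₛ-cong {A = τ ^ₛ k} ≋-refl (zeroₛ-^ₛ l))
      (*ₛ-zeroʳ (τ ^ₛ k)) (a ∷ []))) (zeroʳ _)

  ∘ₛ-zeroₛ-τ : ∀ (F : PS 2) a → (F ∘ₛ (zeroₛ ∷ τ ∷ [])) (a ∷ []) ≈ coeff₂ F 0 a
  ∘ₛ-zeroₛ-τ F a = begin
    (F ∘ₛ (zeroₛ ∷ τ ∷ [])) (a ∷ [])
      ≈⟨ ∘ₛ-Σ₂ F zeroₛ τ a ⟩
    Σ< (suc a) (λ k → Σ< (suc a) (term k))
      ≈⟨ Σ-single {f = λ k → Σ< (suc a) (term k)} 0 (s≤s z≤n) off ⟩
    Σ< (suc a) (term 0)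
      ≈⟨ Σ-cong (suc a) (λ l _ → *-congˡ {coeff₂ F 0 l} (*ₛ-identityˡ (τ ^ₛ l) (a ∷ []))) ⟩
    Σ< (suc a) (λ l → coeff₂ F 0 l * (τ ^ₛ l) (a ∷ []))
      ≈⟨ Σ-*-τ^ (coeff₂ F 0) a ⟩
    coeff₂ F 0 a ∎
    where
    term : ℕ → ℕ → Carrier
    term k l = coeff₂ F k l * ((zeroₛ ^ₛ k) *ₛ (τ ^ₛ l)) (a ∷ [])

    off : ∀ k → k < suc a → k ≢ 0 → Σ< (suc a) (term k) ≈ 0#
    off 0       _ 0≢0 = contradiction ≡.refl 0≢0
    off (suc k) _ _   = Σ-zero (suc a) (λ l _ → trans (*-congˡ {coeff₂ F (suc k) l} (≋-trans
      (*ₛ-cong {B = τ ^ₛ l} (zeroₛ-^ₛ k) ≋-refl) (*ₛ-zeroˡ (τ ^ₛ l)) (a ∷ []))) (zeroʳ _))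

  -- Stated for any F without constant term because it is also applied to the truncation of a formal
  -- group law.
  order-mulF′ : ∀ {F} → Order≥ 1 F → ∀ k → Order≥ 1 (mulF F k)
  order-mulF′ oF 0             = order-zeroₛ
  order-mulF′ oF 1             = order-X Fin.zero
  order-mulF′ oF (suc (suc k)) = order-∘ₛ oF (order-mulF′ oF (suc k) ∷ order-X Fin.zero ∷ [])

  -- The reason why C involves only the f_kl with k + l at most q i.
  mulF-cong-Total≤ : ∀ D {F F′ : PS 2} → Order≥ 1 F → Order≥ 1 F′ → F ≈[ Total≤ D ] F′ →
                     ∀ k → mulF F k ≈[ Total≤ D ] mulF F′ k
  mulF-cong-Total≤ D oF oF′ F≈ 0             α _ = refl
  mulF-cong-Total≤ D oF oF′ F≈ 1             α _ = refl
  mulF-cong-Total≤ D oF oF′ F≈ (suc (suc k)) = ∘ₛ-cong-Total≤ D F≈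
    (mulF-cong-Total≤ D oF oF′ F≈ (suc k) ∷ (λ _ _ → refl) ∷ [])
    (order-mulF′ oF (suc k) ∷ order-X Fin.zero ∷ []) (order-mulF′ oF′ (suc k) ∷ order-X Fin.zero ∷ [])

  module _ (F : PS 2) (fgl : IsFGL F) where
    private
      F-unit  = proj₁ fgl
      F-comm  = proj₁ (proj₂ fgl)
      F-assoc = proj₂ (proj₂ fgl)

    coeff₂-unit : ∀ a → coeff₂ F a 0 ≈ coeff₁ τ a
    coeff₂-unit a = trans (sym (∘ₛ-τ-zeroₛ F a)) (F-unit (a ∷ []))

    order-F : Order≥ 1 F
    order-F (0 ∷ 0 ∷ []) _ = coeff₂-unit 0
    order-F (0 ∷ suc _ ∷ []) (s≤s ())
    order-F (suc _ ∷ _ ∷ []) (s≤s ())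

    infixl 6 _⊞_
    _⊞_ : ∀ {n} → PS n → PS n → PS n
    x ⊞ y = F ∘ₛ (x ∷ y ∷ [])

    order-⊞ : ∀ {n} {x y : PS n} → Order≥ 1 x → Order≥ 1 y → Order≥ 1 (x ⊞ y)
    order-⊞ ox oy = order-∘ₛ order-F (ox ∷ oy ∷ [])

    ⊞-cong : ∀ {n} {x x′ y y′ : PS n} → x ≋ x′ → y ≋ y′ → (x ⊞ y) ≋ (x′ ⊞ y′)
    ⊞-cong x≋ y≋ = ∘ₛ-congʳ F (x≋ ∷ y≋ ∷ [])

    ⊞-∘ₛ : ∀ {m n} {x y : PS m} {Hs : Vec (PS n) m} → Order≥ 1 x → Order≥ 1 y → All (Order≥ 1) Hs →
           ((x ⊞ y) ∘ₛ Hs) ≋ ((x ∘ₛ Hs) ⊞ (y ∘ₛ Hs))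
    ⊞-∘ₛ ox oy oHs = ∘ₛ-assoc F (ox ∷ oy ∷ []) oHs

    -- The axiom speaks of the variables; associativity of composition carries it to arbitrary
    -- series without constant term. The unit and associativity laws are transferred in the same
    -- way.
    ⊞-comm : ∀ {n} {x y : PS n} → Order≥ 1 x → Order≥ 1 y → (x ⊞ y) ≋ (y ⊞ x)
    ⊞-comm {x = x} {y} ox oy =
      ≋-trans (∘ₛ-congˡ (x ∷ y ∷ []) (≋-sym F-comm))
      (≋-trans (⊞-∘ₛ (order-X _) (order-X _) oxy)
      (⊞-cong (X-∘ₛ (Fin.suc Fin.zero) oxy) (X-∘ₛ Fin.zero oxy)))
      where oxy = ox ∷ oy ∷ []

    F-X₁-X₂ : F ≋ (X₁ ⊞ X₂)
    F-X₁-X₂ = ≋-trans (≋-sym F-comm) (⊞-comm (order-X _) (order-X _))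

    ⊞-identityʳ : ∀ {n} {x : PS n} → Order≥ 1 x → (x ⊞ zeroₛ) ≋ x
    ⊞-identityʳ {x = x} ox = ≋-trans
      (⊞-cong (≋-sym (X-∘ₛ Fin.zero (ox ∷ []))) (≋-sym (λ α → trans
        (sumL-box 1 (total α) (λ β → 0# * prodPow (x ∷ []) β α))
        (Σbox-zero 1 (total α) (λ β → zeroˡ (prodPow (x ∷ []) β α))))))
      (≋-trans (≋-sym (⊞-∘ₛ (order-X Fin.zero) order-zeroₛ (ox ∷ [])))
      (≋-trans (∘ₛ-congˡ (x ∷ []) F-unit) (X-∘ₛ Fin.zero (ox ∷ []))))

    coeff₂-unitʳ : ∀ b → coeff₂ F 0 b ≈ coeff₁ τ b
    coeff₂-unitʳ b = trans (sym (∘ₛ-zeroₛ-τ F b))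
      (trans (⊞-comm order-zeroₛ (order-X Fin.zero) (b ∷ [])) (F-unit (b ∷ [])))

    ⊞-assoc : ∀ {n} {x y z : PS n} → Order≥ 1 x → Order≥ 1 y → Order≥ 1 z →
              ((x ⊞ y) ⊞ z) ≋ (x ⊞ (y ⊞ z))
    ⊞-assoc {x = x} {y} {z} ox oy oz = ≋-trans
      (≋-sym (≋-trans (⊞-∘ₛ (order-⊞ oY₁ oY₂) oY₃ oHs)
                      (⊞-cong (≋-trans (⊞-∘ₛ oY₁ oY₂ oHs) (⊞-cong Y₁≋ Y₂≋)) Y₃≋)))
      (≋-trans (∘ₛ-congˡ (x ∷ y ∷ z ∷ []) F-assoc)
      (≋-trans (⊞-∘ₛ oY₁ (order-⊞ oY₂ oY₃) oHs)
               (⊞-cong Y₁≋ (≋-trans (⊞-∘ₛ oY₂ oY₃ oHs) (⊞-cong Y₂≋ Y₃≋)))))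
      where
      oHs = ox ∷ oy ∷ oz ∷ []
      oY₁ = order-X {3} Fin.zero
      oY₂ = order-X {3} (Fin.suc Fin.zero)
      oY₃ = order-X {3} (Fin.suc (Fin.suc Fin.zero))
      Y₁≋ = X-∘ₛ Fin.zero oHs
      Y₂≋ = X-∘ₛ (Fin.suc Fin.zero) oHs
      Y₃≋ = X-∘ₛ (Fin.suc (Fin.suc Fin.zero)) oHs

    -- Gives access to `interchange`, by which multiplication by k is additive. The order condition
    -- is part of the carrier because the laws are proved for series without constant term.
    ⊞-commutativeSemigroup : ℕ → CommutativeSemigroup _ _
    ⊞-commutativeSemigroup n = record
      { Carrier = Σ (PS n) (Order≥ 1)
      ; _≈_     = λ x y → proj₁ x ≋ proj₁ y
      ; _∙_     = λ x y → proj₁ x ⊞ proj₁ y , order-⊞ (proj₂ x) (proj₂ y)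
      ; isCommutativeSemigroup = record
        { isSemigroup = record
          { isMagma = record
            { isEquivalence = record { refl = ≋-refl ; sym = ≋-sym ; trans = ≋-trans }
            ; ∙-cong = ⊞-cong
            }
          ; assoc = λ x y z → ⊞-assoc (proj₂ x) (proj₂ y) (proj₂ z)
          }
        ; comm = λ x y → ⊞-comm (proj₂ x) (proj₂ y)
        }
      }

    order-mulF : ∀ k → Order≥ 1 (mulF F k)
    order-mulF = order-mulF′ order-F

    mulF-suc-∘ₛ : ∀ {n} k {x : PS n} → Order≥ 1 x →
      (mulF F (suc (suc k)) ∘ₛ (x ∷ [])) ≋ ((mulF F (suc k) ∘ₛ (x ∷ [])) ⊞ x)
    mulF-suc-∘ₛ k {x} ox = ≋-trans (⊞-∘ₛ (order-mulF (suc k)) (order-X Fin.zero) (ox ∷ []))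
      (⊞-cong ≋-refl (X-∘ₛ Fin.zero (ox ∷ [])))

    mulF-⊞ : ∀ {n} k {x y : PS n} → Order≥ 1 x → Order≥ 1 y →
      (mulF F (suc k) ∘ₛ ((x ⊞ y) ∷ [])) ≋ ((mulF F (suc k) ∘ₛ (x ∷ [])) ⊞ (mulF F (suc k) ∘ₛ (y ∷ [])))
    mulF-⊞ 0 ox oy = ≋-trans (X-∘ₛ Fin.zero (order-⊞ ox oy ∷ []))
      (≋-sym (⊞-cong (X-∘ₛ Fin.zero (ox ∷ [])) (X-∘ₛ Fin.zero (oy ∷ []))))
    mulF-⊞ (suc k) {x} {y} ox oy = ≋-trans (mulF-suc-∘ₛ k (order-⊞ ox oy))
      (≋-trans (⊞-cong (mulF-⊞ k ox oy) ≋-refl)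
      (≋-trans (interchange (_ , order-∘ₛ (order-mulF (suc k)) (ox ∷ []))
                            (_ , order-∘ₛ (order-mulF (suc k)) (oy ∷ [])) (x , ox) (y , oy))
      (≋-sym (⊞-cong (mulF-suc-∘ₛ k ox) (mulF-suc-∘ₛ k oy)))))
      where open import Algebra.Properties.CommutativeSemigroup (⊞-commutativeSemigroup _)

  module _ (F F′ : PS 2) (fgl : IsFGL F) (fgl′ : IsFGL F′) (U : PS 1) (hom : IsHom F F′ U) where
    order-U : Order≥ 1 U
    order-U (0 ∷ [])     _ = proj₁ hom
    order-U (suc _ ∷ []) (s≤s ())

    hom-⊞ : ∀ {n} {x y : PS n} → Order≥ 1 x → Order≥ 1 y →
      (U ∘ₛ ((F ∘ₛ (x ∷ y ∷ [])) ∷ [])) ≋ (F′ ∘ₛ ((U ∘ₛ (x ∷ [])) ∷ (U ∘ₛ (y ∷ [])) ∷ []))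
    hom-⊞ {x = x} {y} ox oy =
      ≋-trans (≋-sym (∘ₛ-assoc U (order-F F fgl ∷ []) oxy))
      (≋-trans (∘ₛ-congˡ (x ∷ y ∷ []) (proj₂ hom))
      (≋-trans (∘ₛ-assoc F′ (order-∘ₛ order-U (order-X _ ∷ []) ∷ order-∘ₛ order-U (order-X _ ∷ []) ∷ []) oxy)
      (∘ₛ-congʳ F′ (component Fin.zero ∷ component (Fin.suc Fin.zero) ∷ []))))
      where
      oxy = ox ∷ oy ∷ []
      component : ∀ i → ((U ∘ₛ (X i ∷ [])) ∘ₛ (x ∷ y ∷ [])) ≋ (U ∘ₛ (lookup (x ∷ y ∷ []) i ∷ []))
      component i = ≋-trans (∘ₛ-assoc U (order-X i ∷ []) oxy) (∘ₛ-congʳ U (X-∘ₛ i oxy ∷ []))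

    hom-mulF : ∀ {k} → 0 < k → (U ∘ₛ (mulF F k ∷ [])) ≋ (mulF F′ k ∘ₛ (U ∷ []))
    hom-mulF {1}           _ = ≋-trans (∘ₛ-τ U) (≋-sym (X-∘ₛ Fin.zero (order-U ∷ [])))
    hom-mulF {suc (suc k)} _ = ≋-trans (hom-⊞ (order-mulF F fgl (suc k)) (order-X Fin.zero))
      (≋-trans (∘ₛ-congʳ F′ (hom-mulF {suc k} (s≤s z≤n) ∷ ∘ₛ-τ U ∷ []))
      (≋-sym (mulF-suc-∘ₛ F′ fgl′ k order-U)))

-- Height and the first nonzero coefficient of [p]

module Height {c ℓ : Level} (R : CommutativeRing c ℓ) where
  open CommutativeRing R
  open Series R
  open PowerSeries R
  open Truncation R
  open Composition R hiding (Q)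
  open Frobenius R
  open FormalGroup R
  open FiniteSum R
  open Powers R using (^ᴿ-cong; 0^ᴿ≈0; ∣⇒natR≈0; natR≈0⇒∣)
  open import Relation.Binary.Reasoning.Setoid setoid
  private module P {n : ℕ} = CommutativeRing (psRing n)

  -- Being a series in τ ^ Q, expressed without substitution; the next two lemmas relate it to
  -- `FactorsThrough`.
  VanishesOff : ℕ → PS 1 → Set ℓ
  VanishesOff Q A = ∀ k → Q ∤ k → coeff₁ A k ≈ 0#

  factors⇒vanishes : ∀ p h {A} → FactorsThrough p A h → VanishesOff (p ^ h) A
  factors⇒vanishes p h {A} (V , A≋V∘) k Q∤k = begin
    coeff₁ A k
      ≈⟨ A≋V∘ (k ∷ []) ⟩
    (V ∘ₛ ((τ ^ₛ Q) ∷ [])) (k ∷ [])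
      ≈⟨ ∘ₛ-Σ V (τ ^ₛ Q) (k ∷ []) (total₁ k) ⟩
    Σ< (suc k) (λ j → coeff₁ V j * ((τ ^ₛ Q) ^ₛ j) (k ∷ []))
      ≈⟨ Σ-zero (suc k) (λ j _ → trans (*-congˡ {coeff₁ V j} (trans (^ₛ-assoc τ Q j (k ∷ []))
           (X₀^-offdiag (Q ℕ.* j) k [] (λ { ≡.refl → Q∤k (∣.m∣m*n j) })))) (zeroʳ _)) ⟩
    0# ∎
    where Q = p ^ h

  vanishes⇒factors : ∀ p h {A} → 0 < p ^ h → VanishesOff (p ^ h) A → FactorsThrough p A h
  vanishes⇒factors p h {A} 0<Q vanish = V , λ { (k ∷ []) → sym (coefficient k) }
    where
    Q = p ^ h
    instance _ = ℕ.>-nonZero 0<Q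
    V : PS 1
    V (j ∷ []) = coeff₁ A (Q ℕ.* j)

    term : ℕ → ℕ → Carrier
    term k j = coeff₁ V j * (τ ^ₛ (Q ℕ.* j)) (k ∷ [])

    Σ-term : ∀ k → Σ< (suc k) (term k) ≈ coeff₁ A k
    Σ-term k with Q ∣.∣? k
    ... | no Q∤k = trans (Σ-zero (suc k) (λ j _ → trans
      (*-congˡ (X₀^-offdiag (Q ℕ.* j) k [] (λ { ≡.refl → Q∤k (∣.m∣m*n j) }))) (zeroʳ (coeff₁ V j))))
      (sym (vanish k Q∤k))
    ... | yes (divides j k≡jQ) = trans
      (Σ-single {f = term k} j (s≤s (≡.subst (j ≤_) (≡.sym k≡jQ) (ℕₚ.m≤m*n j Q)))
        (λ i _ i≢j → trans (*-congˡ (X₀^-offdiag (Q ℕ.* i) k [] (λ Qi≡k → i≢j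
          (ℕₚ.*-cancelˡ-≡ i j Q (≡.trans Qi≡k k≡Qj))))) (zeroʳ (coeff₁ V i))))
      (≡.subst (λ l → coeff₁ A l * (τ ^ₛ l) (k ∷ []) ≈ coeff₁ A k) k≡Qj
        (trans (*-congˡ (X₀^-diag k [])) (*-identityʳ _)))
      where
      k≡Qj : k ≡ Q ℕ.* j
      k≡Qj = ≡.trans k≡jQ (ℕₚ.*-comm j Q)

    coefficient : ∀ k → (V ∘ₛ ((τ ^ₛ Q) ∷ [])) (k ∷ []) ≈ coeff₁ A k
    coefficient k = trans (∘ₛ-Σ V (τ ^ₛ Q) (k ∷ []) (total₁ k))
      (trans (Σ-cong (suc k) (λ j _ → *-congˡ {coeff₁ V j} (^ₛ-assoc τ Q j (k ∷ [])))) (Σ-term k))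

  row : ℕ → PS 2 → PS 1
  row b A (a ∷ []) = A (a ∷ b ∷ [])

  row₀-*ₛ : ∀ A B → row 0 (A *ₛ B) ≋ (row 0 A *ₛ row 0 B)
  row₀-*ₛ A B (a ∷ []) = trans (*ₛ-slice A B a (0 ∷ []))
    (trans (Σ-cong (suc a) (λ k _ → trans (*ₛ-slice (slice A k) (slice B (a ∸ k)) 0 []) (+-identityʳ _)))
    (sym (*ₛ-slice (row 0 A) (row 0 B) a [])))

  -- The Leibniz rule: `row 1` is the derivative in the second variable at 0, and `row 0` is the
  -- value there.
  row₁-*ₛ : ∀ A B → row 1 (A *ₛ B) ≋ ((row 0 A *ₛ row 1 B) +ₛ (row 1 A *ₛ row 0 B))
  row₁-*ₛ A B (a ∷ []) = trans (*ₛ-slice A B a (1 ∷ []))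
    (trans (Σ-cong (suc a) (λ k _ → trans (*ₛ-slice (slice A k) (slice B (a ∸ k)) 1 []) (+-congˡ (+-identityʳ _))))
    (trans (Σ-+ (suc a) (λ k → (slice (row 0 A) k *ₛ slice (row 1 B) (a ∸ k)) [])
                        (λ k → (slice (row 1 A) k *ₛ slice (row 0 B) (a ∸ k)) []))
    (sym (+-cong (*ₛ-slice (row 0 A) (row 1 B) a []) (*ₛ-slice (row 1 A) (row 0 B) a [])))))

  X-^ₛ-vanish : ∀ {n} (i : Fin n) k α → lookup α i < k → (X i ^ₛ k) α ≈ 0#
  X-^ₛ-vanish i (suc k) α αᵢ<k = *ₛ-zero-splits α helper
    where
    lookup-+ᵥ : ∀ {n} (i : Fin n) β γ → lookup (β +ᵥ γ) i ≡ lookup β i ℕ.+ lookup γ i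
    lookup-+ᵥ Fin.zero    (_ ∷ _) (_ ∷ _) = ≡.refl
    lookup-+ᵥ (Fin.suc i) (_ ∷ β) (_ ∷ γ) = lookup-+ᵥ i β γ

    helper : ∀ β γ → β +ᵥ γ ≡ α → X i β * (X i ^ₛ k) γ ≈ 0#
    helper β γ ≡.refl with lookup β i ℕ.≟ 1
    ... | no  βᵢ≢1 = trans (*-congʳ (reflexive (X-vanish-lookup i β βᵢ≢1))) (zeroˡ _)
    ... | yes βᵢ≡1 = trans (*-congˡ (X-^ₛ-vanish i k γ (ℕₚ.≤-pred (≡.subst (_< suc k)
      (≡.trans (lookup-+ᵥ i β γ) (≡.cong (ℕ._+ lookup γ i) βᵢ≡1)) αᵢ<k)))) (zeroʳ _)

  module _ (F : PS 2) (fgl : IsFGL F) where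
    row₀-F : row 0 F ≋ τ
    row₀-F (a ∷ []) = coeff₂-unit F fgl a

    row₀-F^ : ∀ m → row 0 (F ^ₛ m) ≋ (τ ^ₛ m)
    row₀-F^ 0       (a ∷ []) = refl
    row₀-F^ (suc m) = ≋-trans (row₀-*ₛ F (F ^ₛ m)) (*ₛ-cong row₀-F (row₀-F^ m))

    -- The chain rule for F ^ (m + 1) in the second variable at 0, where F(X, 0) = X.
    row₁-F^ : ∀ m → row 1 (F ^ₛ suc m) ≋ (constₛ (natR (suc m)) *ₛ ((τ ^ₛ m) *ₛ row 1 F))
    row₁-F^ 0 (a ∷ []) = begin
      (F *ₛ oneₛ) (a ∷ 1 ∷ [])
        ≈⟨ *ₛ-identityʳ F (a ∷ 1 ∷ []) ⟩
      row 1 F (a ∷ [])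
        ≈⟨ *ₛ-identityˡ (row 1 F) (a ∷ []) ⟨
      (oneₛ *ₛ row 1 F) (a ∷ [])
        ≈⟨ trans (*-congʳ (+-identityʳ 1#)) (*-identityˡ _) ⟨
      natR 1 * (oneₛ *ₛ row 1 F) (a ∷ [])
        ≈⟨ constₛ-*ₛ (natR 1) (oneₛ *ₛ row 1 F) (a ∷ []) ⟨
      (constₛ (natR 1) *ₛ (oneₛ *ₛ row 1 F)) (a ∷ []) ∎
    row₁-F^ (suc m) α = begin
      row 1 (F *ₛ (F ^ₛ suc m)) α
        ≈⟨ row₁-*ₛ F (F ^ₛ suc m) α ⟩
      (row 0 F *ₛ row 1 (F ^ₛ suc m)) α + (row 1 F *ₛ row 0 (F ^ₛ suc m)) α
        ≈⟨ +-cong (*ₛ-cong row₀-F (row₁-F^ m) α)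
                  (*ₛ-cong {A = row 1 F} ≋-refl (row₀-F^ (suc m)) α) ⟩
      (τ *ₛ (constₛ n *ₛ ((τ ^ₛ m) *ₛ row 1 F))) α + (row 1 F *ₛ (τ ^ₛ suc m)) α
        ≈⟨ +-cong (≋-trans (x∙yz≈y∙xz τ (constₛ n) _)
                     (*ₛ-cong {A = constₛ n} ≋-refl (≋-sym (*ₛ-assoc τ (τ ^ₛ m) (row 1 F)))) α)
                  (*ₛ-comm (row 1 F) (τ ^ₛ suc m) α) ⟩
      (constₛ n *ₛ Y) α + Y α
        ≈⟨ +-cong (constₛ-*ₛ n Y α) (sym (*-identityˡ (Y α))) ⟩
      n * Y α + 1# * Y α
        ≈⟨ trans (+-comm _ _) (sym (distribʳ (Y α) 1# n)) ⟩
      natR (suc (suc m)) * Y α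
        ≈⟨ constₛ-*ₛ (natR (suc (suc m))) Y α ⟨
      (constₛ (natR (suc (suc m))) *ₛ Y) α ∎
      where
      open import Algebra.Properties.CommutativeSemigroup (CommutativeRing.*-commutativeSemigroup (psRing 1))
      n = natR (suc m)
      Y = (τ ^ₛ suc m) *ₛ row 1 F

    F^-linear : ∀ m a → (F ^ₛ suc m) (a ∷ 1 ∷ []) ≈ natR (suc m) * ((τ ^ₛ m) *ₛ row 1 F) (a ∷ [])
    F^-linear m a = trans (row₁-F^ m (a ∷ []))
      (constₛ-*ₛ (natR (suc m)) ((τ ^ₛ m) *ₛ row 1 F) (a ∷ []))

    -- The factor τ ^ m uses up the whole degree, which leaves the constant term of `row 1 F`, that
    -- is 1 by the unit law.
    F^-linear-diag : ∀ m → (F ^ₛ suc m) (m ∷ 1 ∷ []) ≈ natR (suc m)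
    F^-linear-diag m = begin
      (F ^ₛ suc m) (m ∷ 1 ∷ [])
        ≈⟨ F^-linear m m ⟩
      natR (suc m) * ((τ ^ₛ m) *ₛ row 1 F) (m ∷ [])
        ≡⟨ ≡.cong (λ k → natR (suc m) * ((τ ^ₛ m) *ₛ row 1 F) (k ∷ [])) (ℕₚ.+-identityʳ m) ⟨
      natR (suc m) * ((τ ^ₛ m) *ₛ row 1 F) (m ℕ.+ 0 ∷ [])
        ≈⟨ *-congˡ (trans (X₀^-*ₛ (row 1 F) m 0 []) (coeff₂-unitʳ F fgl 1)) ⟩
      natR (suc m) * 1#
        ≈⟨ *-identityʳ _ ⟩
      natR (suc m) ∎

    mulF-F : ∀ {k} → 0 < k →
      (mulF F k ∘ₛ (F ∷ [])) ≋ (F ∘ₛ ((mulF F k ∘ₛ (X₁ ∷ [])) ∷ (mulF F k ∘ₛ (X₂ ∷ [])) ∷ []))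
    mulF-F {suc k} _ = ≋-trans (∘ₛ-congʳ (mulF F (suc k)) (F-X₁-X₂ F fgl ∷ []))
      (mulF-⊞ F fgl k (order-X _) (order-X _))

    module _ {p h : ℕ} (pp : Prime p) (char : natR p ≈ 0#) (domain : IsIntegralDomain) where
      private
        q : ℕ
        q = p ^ h
        [p] : PS 1
        [p] = mulF F p
        instance
          p≢0 = prime⇒nonZero pp
          q≢0 = ℕₚ.m^n≢0 p h
        0<q : 0 < q
        0<q = ℕ.>-nonZero⁻¹ q

      ^ᴿ≈0 : ∀ {x} k → x ^ᴿ k ≈ 0# → x ≈ 0#
      ^ᴿ≈0 0       1≈0 = contradiction 1≈0 (proj₁ domain)
      ^ᴿ≈0 {x} (suc k) eq with proj₂ domain x (x ^ᴿ k) eq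
      ... | inj₁ x≈0  = x≈0
      ... | inj₂ xᵏ≈0 = ^ᴿ≈0 k xᵏ≈0

      module _ (vanish : VanishesOff q [p]) (vanish-q : coeff₁ [p] q ≈ 0#) where
        private
          [p]-zero : coeff₁ [p] 0 ≈ 0#
          [p]-zero = order-mulF F fgl p (0 ∷ []) (s≤s z≤n)

          [p]-≤q : ∀ k → k ≤ q → coeff₁ [p] k ≈ 0#
          [p]-≤q 0       _   = [p]-zero
          [p]-≤q (suc k) k<q with suc k ℕ.≟ q
          ... | yes k≡q = trans (reflexive (≡.cong (coeff₁ [p]) k≡q)) vanish-q
          ... | no  k≢q = vanish (suc k) (∣.>⇒∤ (ℕₚ.≤∧≢⇒< k<q k≢q))

        -- Modulo Y^(q+1) the series [p] X ⊞ [p] Y is [p] X ⊞ 0 = [p] X.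
        mulF-F-vanish : ∀ a → ([p] ∘ₛ (F ∷ [])) (q ·ᵥ (a ∷ 1 ∷ [])) ≈ 0#
        mulF-F-vanish a = begin
          ([p] ∘ₛ (F ∷ [])) α
            ≈⟨ mulF-F (ℕ.>-nonZero⁻¹ p) α ⟩
          (F ∘ₛ (([p] ∘ₛ (X₁ ∷ [])) ∷ ([p] ∘ₛ (X₂ ∷ [])) ∷ [])) α
            ≈⟨ ∘ₛ-cong-on closed F ((λ _ _ → refl) ∷ X₂-vanish ∷ []) α (ℕₚ.≤-reflexive (ℕₚ.*-identityʳ q)) ⟩
          (F ∘ₛ (([p] ∘ₛ (X₁ ∷ [])) ∷ zeroₛ ∷ [])) α
            ≈⟨ ⊞-identityʳ F fgl (order-∘ₛ (order-mulF F fgl p) (order-X _ ∷ [])) α ⟩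
          ([p] ∘ₛ (X₁ ∷ [])) α
            ≈⟨ ∘ₛ-Σ [p] X₁ α ≡.refl ⟩
          Σ< (suc (total α)) (λ k → coeff₁ [p] k * (X₁ ^ₛ k) α)
            ≈⟨ Σ-zero (suc (total α)) (λ k _ → trans (*-congˡ {coeff₁ [p] k} (X₁-vanish k)) (zeroʳ _)) ⟩
          0# ∎
          where
          α : Vec ℕ 2
          α = q ·ᵥ (a ∷ 1 ∷ [])

          L : Vec ℕ 2 → Set
          L β = lookup β (Fin.suc Fin.zero) ≤ q

          closed : Closed L
          closed (_ ∷ b ∷ []) (_ ∷ d ∷ []) b+d≤q = ℕₚ.m+n≤o⇒m≤o b b+d≤q , ℕₚ.m+n≤o⇒n≤o b b+d≤q

          X₂-vanish : ([p] ∘ₛ (X₂ ∷ [])) ≈[ L ] zeroₛ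
          X₂-vanish β βL = trans (∘ₛ-Σ [p] X₂ β ≡.refl) (Σ-zero (suc (total β)) (λ k _ → term k))
            where
            term : ∀ k → coeff₁ [p] k * (X₂ ^ₛ k) β ≈ 0#
            term k with k ℕ.≤? q
            ... | yes k≤q = trans (*-congʳ ([p]-≤q k k≤q)) (zeroˡ _)
            ... | no  k≰q = trans (*-congˡ (X-^ₛ-vanish _ k β (ℕₚ.≤-<-trans βL (ℕₚ.≰⇒> k≰q)))) (zeroʳ _)

          -- The second exponent of `α` is q > 0, and powers of `X₁` do not involve the second
          -- variable.
          X₁-vanish : ∀ k → (X₁ ^ₛ k) α ≈ 0#
          X₁-vanish k with k ℕ.≟ q ℕ.* a
          ... | no  k≢qa   = X₀^-offdiag k (q ℕ.* a) (q ℕ.* 1 ∷ []) k≢qa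
          ... | yes ≡.refl = trans (X₀^-diag (q ℕ.* a) (q ℕ.* 1 ∷ []))
            (one-vanish (≡.subst (0 <_) (≡.sym (ℕₚ.*-identityʳ q)) 0<q))
            where
            one-vanish : ∀ {b} → 0 < b → oneₛ (b ∷ []) ≈ 0#
            one-vanish {suc b} _ = refl

        -- By Frobenius, F ^ (q j) has at `q ·ᵥ α` the q-th power of the coefficient of F ^ j at
        -- `α`. In the step to m + 1 all summands with j ≤ m vanish: for p ∤ j by induction, and for
        -- p ∣ j because the part of F ^ j linear in the second variable is a multiple of j. The
        -- summand j = m + 1 is left, and there the coefficient of F ^ j is m + 1 itself.
        coprime-vanish : ∀ m → p ∤ m → coeff₁ [p] (q ℕ.* m) ≈ 0#
        coprime-vanish = <-rec _ step
          where
          step : ∀ m → (∀ {j} → j < m → p ∤ j → coeff₁ [p] (q ℕ.* j) ≈ 0#) →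
                 p ∤ m → coeff₁ [p] (q ℕ.* m) ≈ 0#
          step 0       IH p∤m = contradiction (p ∣.∣0) p∤m
          step (suc m) IH p∤m = conclude (proj₂ domain _ _ product≈0)
            where
            α : Vec ℕ 2
            α = m ∷ 1 ∷ []

            total-α : total (q ·ᵥ α) ≡ q ℕ.* suc m
            total-α = ≡.trans (≡.cong₂ ℕ._+_ ≡.refl (≡.trans (ℕₚ.+-identityʳ _) (ℕₚ.*-identityʳ q)))
              (≡.trans (ℕₚ.+-comm (q ℕ.* m) q) (≡.sym (ℕₚ.*-suc q m)))

            term : ℕ → Carrier
            term k = coeff₁ [p] k * (F ^ₛ k) (q ·ᵥ α)

            F^-multiple : ∀ j → (F ^ₛ (q ℕ.* j)) (q ·ᵥ α) ≈ ((F ^ₛ j) α) ^ᴿ q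
            F^-multiple j = trans
              (reflexive (≡.cong (λ k → (F ^ₛ k) (q ·ᵥ α)) (ℕₚ.*-comm q j)))
              (trans (sym (^ₛ-assoc F j q (q ·ᵥ α))) (frobenius-iter char pp h (F ^ₛ j) α))

            lower : ∀ j → j < suc m → term (q ℕ.* j) ≈ 0#
            lower 0 _ = trans
              (*-congʳ (trans (reflexive (≡.cong (coeff₁ [p]) (ℕₚ.*-zeroʳ q))) [p]-zero)) (zeroˡ _)
            lower (suc j) j<m = cases (p ∣.∣? suc j)
              where
              cases : Dec (p ∣ suc j) → term (q ℕ.* suc j) ≈ 0#
              cases (no  p∤j) = trans (*-congʳ (IH j<m p∤j)) (zeroˡ _)
              cases (yes p∣j) = trans (*-congˡ (trans (F^-multiple (suc j)) (0^ᴿ≈0 0<q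
                (trans (F^-linear j m) (trans (*-congʳ (∣⇒natR≈0 char p∣j)) (zeroˡ _)))))) (zeroʳ _)

            off : ∀ k → k < suc (q ℕ.* suc m) → k ≢ q ℕ.* suc m → term k ≈ 0#
            off k k≤ k≢ = cases (q ∣.∣? k)
              where
              cases : Dec (q ∣ k) → term k ≈ 0#
              cases (no  q∤k) = trans (*-congʳ (vanish k q∤k)) (zeroˡ _)
              cases (yes (divides j k≡jq)) = trans (reflexive (≡.cong term k≡qj))
                (lower j (ℕₚ.*-cancelˡ-< q j (suc m)
                  (≡.subst (_< q ℕ.* suc m) k≡qj (ℕₚ.≤∧≢⇒< (ℕₚ.≤-pred k≤) k≢))))
                where
                k≡qj : k ≡ q ℕ.* j
                k≡qj = ≡.trans k≡jq (ℕₚ.*-comm j q)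

            product≈0 : coeff₁ [p] (q ℕ.* suc m) * (natR (suc m) ^ᴿ q) ≈ 0#
            product≈0 = begin
              coeff₁ [p] (q ℕ.* suc m) * (natR (suc m) ^ᴿ q)
                ≈⟨ *-congˡ (trans (F^-multiple (suc m)) (^ᴿ-cong q (F^-linear-diag m))) ⟨
              term (q ℕ.* suc m)
                ≈⟨ Σ-single {f = term} (q ℕ.* suc m) (ℕₚ.n<1+n _) off ⟨
              Σ< (suc (q ℕ.* suc m)) term
                ≈⟨ ∘ₛ-Σ [p] F (q ·ᵥ α) total-α ⟨
              ([p] ∘ₛ (F ∷ [])) (q ·ᵥ α)
                ≈⟨ mulF-F-vanish m ⟩
              0# ∎
            conclude : (coeff₁ [p] (q ℕ.* suc m) ≈ 0#) ⊎ (natR (suc m) ^ᴿ q ≈ 0#) →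
                       coeff₁ [p] (q ℕ.* suc m) ≈ 0#
            conclude (inj₁ coeff≈0) = coeff≈0
            conclude (inj₂ power≈0) =
              contradiction (natR≈0⇒∣ char pp (proj₁ domain) (^ᴿ≈0 q power≈0)) p∤m

        vanishes-suc : VanishesOff (p ^ suc h) [p]
        vanishes-suc k pq∤k with q ∣.∣? k
        ... | no  q∤k = vanish k q∤k
        ... | yes (divides j ≡.refl) with p ∣.∣? j
        ...   | yes p∣j = contradiction (∣.*-monoˡ-∣ q p∣j) pq∤k
        ...   | no  p∤j = trans (reflexive (≡.cong (coeff₁ [p]) (ℕₚ.*-comm j q))) (coprime-vanish j p∤j)

      firstNonzero≡q : HeightFGL p F h → ∀ {n} → FirstNonzero [p] n → n ≡ q
      firstNonzero≡q (factors , maximal) {n} (n≉0 , below) with n ℕ.≟ q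
      ... | yes n≡q = n≡q
      ... | no  n≢q with q ∣.∣? n
      ...   | no  q∤n = contradiction (factors⇒vanishes p h factors n q∤n) n≉0
      -- A multiple of q other than 0 and q exceeds q, so `below` makes the coefficient at q vanish,
      -- which puts the height at h + 1 or more.
      ...   | yes q∣n = contradiction
        (maximal (suc h) (vanishes⇒factors p (suc h) (ℕ.>-nonZero⁻¹ _ {{ℕₚ.m^n≢0 p (suc h)}})
          (vanishes-suc (factors⇒vanishes p h factors) (below q q<n))))
        ℕₚ.1+n≰n
        where
        n≢0 : n ≢ 0
        n≢0 ≡.refl = n≉0 (order-mulF F fgl p (0 ∷ []) (s≤s z≤n))
        q<n : q < n
        q<n = ℕₚ.≤∧≢⇒< (∣.∣⇒≤ {{ℕ.≢-nonZero n≢0}} q∣n) (n≢q ∘ ≡.sym)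

-- Equality is trivial: the ring structure only serves to instantiate the series operations
-- symbolically, so that every coefficient becomes a polynomial expression.
polyRing : Set → CommutativeRing 0ℓ 0ℓ
polyRing V = record
  { Carrier = Poly V
  ; _≈_     = λ _ _ → ⊤
  ; _+_     = _⊕_
  ; _*_     = _⊗_
  ; -_      = λ a → a
  ; 0#      = con 0
  ; 1#      = con 1
  ; isCommutativeRing = record
    { isRing = record
      { +-isAbelianGroup = record
        { isGroup = record
          { isMonoid = record
            { isSemigroup = record
              { isMagma = record
                { isEquivalence = record { refl = tt ; sym = λ _ → tt ; trans = λ _ _ → tt }
                ; ∙-cong = λ _ _ → tt
                }
              ; assoc = λ _ _ _ → tt
              }
            ; identity = (λ _ → tt) , (λ _ → tt)
            }
          ; inverse = (λ _ → tt) , (λ _ → tt)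
          ; ⁻¹-cong = λ _ → tt
          }
        ; comm = λ _ _ → tt
        }
      ; *-cong     = λ _ _ → tt
      ; *-assoc    = λ _ _ _ → tt
      ; *-identity = (λ _ → tt) , (λ _ → tt)
      ; distrib    = (λ _ _ _ → tt) , (λ _ _ _ → tt)
      }
    ; *-comm = λ _ _ → tt
    }
  }

-- Evaluation of symbolic series commutes with the series operations

module SymbolicSeries {c ℓ : Level} (R : CommutativeRing c ℓ) {V : Set}
  (ρ : V → CommutativeRing.Carrier R) where
  open CommutativeRing R
  open Series R
  private module S = Series (polyRing V)

  infix 4 _~_
  _~_ : ∀ {n} → S.PS n → PS n → Set ℓ
  A ~ B = ∀ α → eval ρ (A α) ≈ B α

  -- `total`, `splits` and `box` carry the ring as a parameter, so their copies over two rings have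
  -- to be identified by induction.
  total≡ : ∀ {n} (α : Vec ℕ n) → S.total α ≡ total α
  total≡ []      = ≡.refl
  total≡ (a ∷ α) = ≡.cong (a ℕ.+_) (total≡ α)

  splits≡ : ∀ {n} (α : Vec ℕ n) → S.splits α ≡ splits α
  splits≡ []      = ≡.refl
  splits≡ (a ∷ α) = ≡.cong (λ s → concatMap (λ k →
    map (λ βγ → k ∷ proj₁ βγ , a ∸ k ∷ proj₂ βγ) s) (upTo (suc a))) (splits≡ α)

  box≡ : ∀ m d → S.box m d ≡ box m d
  box≡ 0       d = ≡.refl
  box≡ (suc m) d = ≡.cong (λ s → concatMap (λ k → map (k ∷_) s) (upTo (suc d))) (box≡ m d)

  eval-sumL : ∀ {A : Set} {f : A → Poly V} {g : A → Carrier} → (∀ x → eval ρ (f x) ≈ g x) →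
              ∀ xs → eval ρ (S.sumL (map f xs)) ≈ sumL (map g xs)
  eval-sumL f≈g []       = refl
  eval-sumL f≈g (x ∷ xs) = +-cong (f≈g x) (eval-sumL f≈g xs)

  eval-if : ∀ b → eval ρ (if b then con 1 else con 0) ≈ (if b then 1# else 0#)
  eval-if true  = +-identityʳ 1#
  eval-if false = refl

  oneₛ-~ : ∀ {n} → S.oneₛ {n} ~ oneₛ
  oneₛ-~ α rewrite total≡ α = eval-if (total α ≡ᵇ 0)

  X-~ : ∀ {n} (i : Fin n) → S.X i ~ X i
  X-~ i α rewrite total≡ α = eval-if ((lookup α i ≡ᵇ 1) ∧ (total α ≡ᵇ 1))

  *ₛ-~ : ∀ {n} {A B : S.PS n} {A′ B′} → A ~ A′ → B ~ B′ → (A S.*ₛ B) ~ (A′ *ₛ B′)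
  *ₛ-~ A~ B~ α rewrite splits≡ α =
    eval-sumL (λ βγ → *-cong (A~ (proj₁ βγ)) (B~ (proj₂ βγ))) (splits α)

  ^ₛ-~ : ∀ {n} {A : S.PS n} {A′} → A ~ A′ → ∀ k → (A S.^ₛ k) ~ (A′ ^ₛ k)
  ^ₛ-~ A~ 0       = oneₛ-~
  ^ₛ-~ A~ (suc k) = *ₛ-~ A~ (^ₛ-~ A~ k)

  prodPow-~ : ∀ {m n} {Gs : Vec (S.PS n) m} {Gs′} → Pointwise _~_ Gs Gs′ →
              ∀ β → S.prodPow Gs β ~ prodPow Gs′ β
  prodPow-~ []         []      = oneₛ-~
  prodPow-~ (G~ ∷ Gs~) (b ∷ β) = *ₛ-~ (^ₛ-~ G~ b) (prodPow-~ Gs~ β)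

  ∘ₛ-~ : ∀ {m n} {A : S.PS m} {A′} {Gs : Vec (S.PS n) m} {Gs′} → A ~ A′ → Pointwise _~_ Gs Gs′ →
         (A S.∘ₛ Gs) ~ (A′ ∘ₛ Gs′)
  ∘ₛ-~ {m} A~ Gs~ α rewrite total≡ α | box≡ m (total α) =
    eval-sumL (λ β → *-cong (A~ β) (prodPow-~ Gs~ β α)) (box m (total α))

  mulF-~ : ∀ {F : S.PS 2} {F′} → F ~ F′ → ∀ k → S.mulF F k ~ mulF F′ k
  mulF-~ F~ 0             α = refl
  mulF-~ F~ 1               = X-~ Fin.zero
  mulF-~ F~ (suc (suc k))   = ∘ₛ-~ F~ (mulF-~ F~ (suc k) ∷ X-~ Fin.zero ∷ [])

-- Isolating the terms with u_i in a composite

module Coefficients {c ℓ : Level} (R : CommutativeRing c ℓ) where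
  open CommutativeRing R
  open Series R
  open PowerSeries R
  open Truncation R
  open Frobenius R
  open FormalGroup R
  open Height R using (VanishesOff)
  open FiniteSum R
  open Powers R using (^ᴿ-cong; 0^ᴿ≈0)
  open import Relation.Binary.Reasoning.Setoid setoid

  order≥q : ∀ {q P} → Order≥ 1 P → VanishesOff q P → Order≥ q P
  order≥q oP vanish (0 ∷ [])     _   = oP (0 ∷ []) (s≤s z≤n)
  order≥q {q} oP vanish (suc k ∷ []) k<q =
    vanish (suc k) (∣.>⇒∤ (≡.subst (_< q) (total₁ (suc k)) k<q))

  leading-^ₛ : ∀ {q P} → Order≥ q P → ∀ k → coeff₁ (P ^ₛ k) (k ℕ.* q) ≈ coeff₁ P q ^ᴿ k
  leading-^ₛ oP 0       = refl
  leading-^ₛ {q} {P} oP (suc k) = begin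
    coeff₁ (P *ₛ (P ^ₛ k)) (q ℕ.+ k ℕ.* q)
      ≈⟨ *ₛ-slice P (P ^ₛ k) (q ℕ.+ k ℕ.* q) [] ⟩
    Σ< (suc (q ℕ.+ k ℕ.* q)) (λ j → term j + 0#)
      ≈⟨ Σ-cong (suc (q ℕ.+ k ℕ.* q)) (λ j _ → +-identityʳ (term j)) ⟩
    Σ< (suc (q ℕ.+ k ℕ.* q)) term
      ≈⟨ Σ-single {f = term} q (s≤s (ℕₚ.m≤m+n q (k ℕ.* q))) off ⟩
    coeff₁ P q * coeff₁ (P ^ₛ k) (q ℕ.+ k ℕ.* q ∸ q)
      ≡⟨ ≡.cong (λ l → coeff₁ P q * coeff₁ (P ^ₛ k) l) (ℕₚ.m+n∸m≡n q (k ℕ.* q)) ⟩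
    coeff₁ P q * coeff₁ (P ^ₛ k) (k ℕ.* q)
      ≈⟨ *-congˡ (leading-^ₛ oP k) ⟩
    coeff₁ P q ^ᴿ suc k ∎
    where
    term : ℕ → Carrier
    term j = coeff₁ P j * coeff₁ (P ^ₛ k) (q ℕ.+ k ℕ.* q ∸ j)

    -- Below q the first factor has no term; above q less than k q is left for `P ^ₛ k`, whose order
    -- is at least k q.
    off : ∀ j → j < suc (q ℕ.+ k ℕ.* q) → j ≢ q → term j ≈ 0#
    off j j≤ j≢q = cases (ℕₚ.<-cmp j q)
      where
      cases : Tri (j < q) (j ≡ q) (q < j) → term j ≈ 0#
      cases (tri< j<q _ _) = trans (*-congʳ (oP (j ∷ []) (≡.subst (_< q) (≡.sym (total₁ j)) j<q))) (zeroˡ _)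
      cases (tri≈ _ j≡q _) = contradiction j≡q j≢q
      cases (tri> _ _ q<j) = trans (*-congˡ {coeff₁ P j} (order-^ₛ q oP k _ (≡.subst₂ _<_
        (≡.sym (total₁ _)) (ℕₚ.m+n∸m≡n q (k ℕ.* q)) (ℕₚ.∸-monoʳ-< q<j (ℕₚ.≤-pred j≤))))) (zeroʳ _)

  module _ {i : ℕ} {U W : PS 1} (oU : Order≥ 1 U) (oW : Order≥ 1 W)
           (W≈U : ∀ k → k < i → coeff₁ W k ≈ coeff₁ U k) (Wᵢ≈0 : coeff₁ W i ≈ 0#) where

    ∘ₛ-truncated : ∀ {q P} → 0 < q → Order≥ q P →
      coeff₁ (U ∘ₛ (P ∷ [])) (q ℕ.* i) ≈
      coeff₁ (W ∘ₛ (P ∷ [])) (q ℕ.* i) + (coeff₁ P q ^ᴿ i) * coeff₁ U i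
    ∘ₛ-truncated {q} {P} 0<q oP = begin
      coeff₁ (U ∘ₛ (P ∷ [])) N
        ≈⟨ ∘ₛ-Σ U P (N ∷ []) (total₁ N) ⟩
      Σ< (suc N) (λ k → coeff₁ U k * coeff₁ (P ^ₛ k) N)
        ≈⟨ Σ-except {g = λ k → coeff₁ W k * coeff₁ (P ^ₛ k) N} i (s≤s i≤N) (λ k _ → off k) at-i ⟩
      Σ< (suc N) (λ k → coeff₁ W k * coeff₁ (P ^ₛ k) N) + (coeff₁ P q ^ᴿ i) * coeff₁ U i
        ≈⟨ +-congʳ (∘ₛ-Σ W P (N ∷ []) (total₁ N)) ⟨
      coeff₁ (W ∘ₛ (P ∷ [])) N + (coeff₁ P q ^ᴿ i) * coeff₁ U i ∎
      where
      N = q ℕ.* i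
      instance _ = ℕ.>-nonZero 0<q

      i≤N : i ≤ N
      i≤N = ℕₚ.m≤n*m i q

      off : ∀ k → k ≢ i → coeff₁ U k * coeff₁ (P ^ₛ k) N ≈ coeff₁ W k * coeff₁ (P ^ₛ k) N
      off k k≢i = cases (ℕₚ.<-cmp k i)
        where
        cases : Tri (k < i) (k ≡ i) (i < k) → coeff₁ U k * coeff₁ (P ^ₛ k) N ≈ coeff₁ W k * coeff₁ (P ^ₛ k) N
        cases (tri< k<i _ _) = *-congʳ (sym (W≈U k k<i))
        cases (tri≈ _ k≡i _) = contradiction k≡i k≢i
        cases (tri> _ _ i<k) = trans (trans (*-congˡ Pᵏ≈0) (zeroʳ _)) (sym (trans (*-congˡ Pᵏ≈0) (zeroʳ _)))
          where
          Pᵏ≈0 : coeff₁ (P ^ₛ k) N ≈ 0#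
          Pᵏ≈0 = order-^ₛ q oP k (N ∷ []) (≡.subst₂ _<_ (≡.trans (ℕₚ.*-comm i q) (≡.sym (total₁ N))) ≡.refl
            (ℕₚ.*-monoˡ-< q i<k))

      at-i : coeff₁ U i * coeff₁ (P ^ₛ i) N ≈ coeff₁ W i * coeff₁ (P ^ₛ i) N + (coeff₁ P q ^ᴿ i) * coeff₁ U i
      at-i = begin
        coeff₁ U i * coeff₁ (P ^ₛ i) N
          ≈⟨ *-comm _ _ ⟩
        coeff₁ (P ^ₛ i) N * coeff₁ U i
          ≈⟨ *-congʳ (trans (reflexive (≡.cong (coeff₁ (P ^ₛ i)) (ℕₚ.*-comm q i))) (leading-^ₛ oP i)) ⟩
        (coeff₁ P q ^ᴿ i) * coeff₁ U i
          ≈⟨ +-identityˡ _ ⟨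
        0# + (coeff₁ P q ^ᴿ i) * coeff₁ U i
          ≈⟨ +-congʳ (trans (*-congʳ Wᵢ≈0) (zeroˡ _)) ⟨
        coeff₁ W i * coeff₁ (P ^ₛ i) N + (coeff₁ P q ^ᴿ i) * coeff₁ U i ∎

    -- For m ≥ 2 neither constant term contributes, so in each product both factors have degree
    -- below i, where U and W agree.
    ^ₛ-agree : ∀ m → m ≢ 1 → coeff₁ (U ^ₛ m) i ≈ coeff₁ (W ^ₛ m) i
    ^ₛ-agree 0             _   = refl
    ^ₛ-agree 1             1≢1 = contradiction ≡.refl 1≢1
    ^ₛ-agree (suc (suc m)) _   = *ₛ-cong-splits (i ∷ []) helper
      where
      L : Vec ℕ 1 → Set
      L α = total α < i

      closed : Closed L
      closed β γ h = ℕₚ.≤-<-trans (ℕₚ.m≤m+n _ _) h′ , ℕₚ.≤-<-trans (ℕₚ.m≤n+m _ (total β)) h′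
        where h′ = ≡.subst (_< i) (total-+ᵥ β γ) h

      U≈W : U ≈[ L ] W
      U≈W (k ∷ []) k<i = sym (W≈U k (≡.subst (_< i) (total₁ k) k<i))

      power-zero : ∀ {A} → Order≥ 1 A → coeff₁ (A ^ₛ suc m) 0 ≈ 0#
      power-zero oA = order-^ₛ 1 oA (suc m) (0 ∷ []) (s≤s z≤n)

      helper : ∀ β γ → β +ᵥ γ ≡ i ∷ [] → U β * (U ^ₛ suc m) γ ≈ W β * (W ^ₛ suc m) γ
      helper (0 ∷ [])     (d ∷ [])     _  = trans
        (trans (*-congʳ (oU (0 ∷ []) (s≤s z≤n))) (zeroˡ _))
        (sym (trans (*-congʳ (oW (0 ∷ []) (s≤s z≤n))) (zeroˡ _)))
      helper (suc b ∷ []) (0 ∷ [])     _  = trans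
        (trans (*-congˡ {U (suc b ∷ [])} (power-zero oU)) (zeroʳ _))
        (sym (trans (*-congˡ {W (suc b ∷ [])} (power-zero oW)) (zeroʳ _)))
      helper (suc b ∷ []) (suc d ∷ []) eq = *-cong
        (U≈W (suc b ∷ []) (≡.subst₂ _<_ (≡.sym (total₁ (suc b))) b+d≡i (ℕₚ.m<m+n (suc b) (s≤s z≤n))))
        (^ₛ-cong-on closed U≈W (suc m) (suc d ∷ [])
          (≡.subst₂ _<_ (≡.sym (total₁ (suc d))) b+d≡i (ℕₚ.m<n+m (suc d) (s≤s z≤n))))
        where
        b+d≡i : suc b ℕ.+ suc d ≡ i
        b+d≡i = ≡.cong Vec.head eq

    truncated-∘ₛ : ∀ {p h P} → natR p ≈ 0# → Prime p → 0 < i → VanishesOff (p ^ h) P →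
      coeff₁ (P ∘ₛ (U ∷ [])) (p ^ h ℕ.* i) ≈
      coeff₁ (P ∘ₛ (W ∷ [])) (p ^ h ℕ.* i) + coeff₁ P (p ^ h) * (coeff₁ U i ^ᴿ (p ^ h))
    truncated-∘ₛ {p} {h} {P} char pp 0<i vanish = begin
      coeff₁ (P ∘ₛ (U ∷ [])) N
        ≈⟨ ∘ₛ-Σ P U (N ∷ []) (total₁ N) ⟩
      Σ< (suc N) (term U)
        ≈⟨ Σ-except {g = term W} q (s≤s (ℕₚ.m≤m*n q i)) (λ k _ → off k) at-q ⟩
      Σ< (suc N) (term W) + coeff₁ P q * (coeff₁ U i ^ᴿ q)
        ≈⟨ +-congʳ (∘ₛ-Σ P W (N ∷ []) (total₁ N)) ⟨
      coeff₁ (P ∘ₛ (W ∷ [])) N + coeff₁ P q * (coeff₁ U i ^ᴿ q) ∎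
      where
      q = p ^ h
      N = q ℕ.* i
      instance
        _ = ℕ.>-nonZero 0<i
        _ = prime⇒nonZero pp
        _ = ℕₚ.m^n≢0 p h

      term : PS 1 → ℕ → Carrier
      term A k = coeff₁ P k * coeff₁ (A ^ₛ k) N

      power : ∀ A m → coeff₁ (A ^ₛ (m ℕ.* q)) N ≈ coeff₁ (A ^ₛ m) i ^ᴿ q
      power A m = trans (sym (^ₛ-assoc A m q (N ∷ []))) (frobenius-iter char pp h (A ^ₛ m) (i ∷ []))

      power₁ : ∀ A → coeff₁ (A ^ₛ q) N ≈ coeff₁ A i ^ᴿ q
      power₁ A = frobenius-iter char pp h A (i ∷ [])

      off : ∀ k → k ≢ q → term U k ≈ term W k
      off k k≢q = cases (q ∣.∣? k)
        where
        cases : Dec (q ∣ k) → term U k ≈ term W k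
        cases (no  q∤k) = trans (trans (*-congʳ (vanish k q∤k)) (zeroˡ _))
          (sym (trans (*-congʳ (vanish k q∤k)) (zeroˡ _)))
        cases (yes (divides m ≡.refl)) = *-congˡ {coeff₁ P k} (trans (power U m)
          (trans (^ᴿ-cong q (^ₛ-agree m (λ { ≡.refl → k≢q (ℕₚ.*-identityˡ q) }))) (sym (power W m))))

      at-q : term U q ≈ term W q + coeff₁ P q * (coeff₁ U i ^ᴿ q)
      at-q = begin
        term U q
          ≈⟨ *-congˡ {coeff₁ P q} (power₁ U) ⟩
        coeff₁ P q * (coeff₁ U i ^ᴿ q)
          ≈⟨ +-identityˡ _ ⟨
        0# + coeff₁ P q * (coeff₁ U i ^ᴿ q)
          ≈⟨ +-congʳ (trans (*-congˡ {coeff₁ P q} (trans (power₁ W)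
               (0^ᴿ≈0 (ℕ.>-nonZero⁻¹ q) Wᵢ≈0))) (zeroʳ _)) ⟨
        term W q + coeff₁ P q * (coeff₁ U i ^ᴿ q) ∎

-- The universal polynomial and its specialisation

module Universal (i N : ℕ) where
  open Series (polyRing (Var i N))

  -- The default 0 makes this the truncation W with indeterminate coefficients; in particular its
  -- coefficient at i is 0.
  Û : PS 1
  Û (j ∷ []) with j ℕ.<? i
  ... | yes j<i = var (Defs.u j j<i)
  ... | no  _   = con 0

  F̂ F̂′ : PS 2
  F̂ (k ∷ l ∷ []) with k ℕ.+ l ℕ.≤? N
  ... | yes k+l≤N = var (Defs.f k l k+l≤N)
  ... | no  _     = con 0
  F̂′ (k ∷ l ∷ []) with k ℕ.+ l ℕ.≤? N
  ... | yes k+l≤N = var (Defs.f′ k l k+l≤N)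
  ... | no  _     = con 0

  -- con (p ∸ 1) plays the role of - 1.
  Ĉ : ℕ → Poly (Var i N)
  Ĉ p = coeff₁ (Û ∘ₛ (mulF F̂ p ∷ [])) N ⊕ (con (p ∸ 1) ⊗ coeff₁ (mulF F̂′ p ∘ₛ (Û ∷ [])) N)

module Specialisation {c ℓ : Level} (R : CommutativeRing c ℓ) (i N : ℕ)
  (U : Series.PS R 1) (F F′ : Series.PS R 2) where
  open CommutativeRing R
  open Series R
  open Truncation R
  open FormalGroup R
  open Universal i N
  open SymbolicSeries R (valuation {i} {N} U F F′)
  open Coefficients R
  open Height R
  open import Algebra.Properties.Ring ring using (-1*x≈-x; +-cancelˡ)
  open import Relation.Binary.Reasoning.Setoid setoid

  ρ : Var i N → Carrier
  ρ = valuation U F F′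

  W : PS 1
  W α = eval ρ (Û α)

  G G′ : PS 2
  G  α = eval ρ (F̂ α)
  G′ α = eval ρ (F̂′ α)

  W≈U : ∀ k → k < i → coeff₁ W k ≈ coeff₁ U k
  W≈U k k<i with k ℕ.<? i
  ... | yes _   = refl
  ... | no  k≮i = contradiction k<i k≮i

  Wᵢ≈0 : coeff₁ W i ≈ 0#
  Wᵢ≈0 with i ℕ.<? i
  ... | yes i<i = contradiction i<i (ℕₚ.<-irrefl ≡.refl)
  ... | no  _   = refl

  G≈F : F ≈[ Total≤ N ] G
  G≈F (k ∷ l ∷ []) h with k ℕ.+ l ℕ.≤? N
  ... | yes _     = refl
  ... | no  k+l≰N = contradiction (≡.subst (_≤ N) (≡.cong (k ℕ.+_) (ℕₚ.+-identityʳ l)) h) k+l≰N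

  G′≈F′ : F′ ≈[ Total≤ N ] G′
  G′≈F′ (k ∷ l ∷ []) h with k ℕ.+ l ℕ.≤? N
  ... | yes _     = refl
  ... | no  k+l≰N = contradiction (≡.subst (_≤ N) (≡.cong (k ℕ.+_) (ℕₚ.+-identityʳ l)) h) k+l≰N

  order-≈ : ∀ {A B : PS 2} → Order≥ 1 A → A ≈[ Total≤ N ] B → Order≥ 1 B
  order-≈ oA A≈B α α<1 = trans (sym (A≈B α (ℕₚ.≤-trans (ℕₚ.≤-pred α<1) z≤n))) (oA α α<1)

  -1≈ : ∀ {p} → Prime p → natR p ≈ 0# → natR (p ∸ 1) ≈ - 1#
  -1≈ {0}     pp char = contradiction pp ¬prime[0]
  -1≈ {suc p} pp char = +-cancelˡ 1# _ _ (trans char (sym (-‿inverseʳ 1#)))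

  -- Evaluation yields the same expression in the truncations `G` and `G′`; the coefficient at N
  -- does not distinguish them from `F` and `F′`.
  eval-Ĉ : ∀ {p} → Prime p → natR p ≈ 0# → Order≥ 1 F → Order≥ 1 F′ → Order≥ 1 W →
    eval ρ (Ĉ p) ≈ coeff₁ (W ∘ₛ (mulF F p ∷ [])) N - coeff₁ (mulF F′ p ∘ₛ (W ∷ [])) N
  eval-Ĉ {p} pp char oF oF′ oW = +-cong
    (trans (∘ₛ-~ {A = Û} {W} (λ α → refl) (mulF-~ {F̂} {G} (λ α → refl) p ∷ []) (N ∷ []))
      (sym (∘ₛ-cong-Total≤ N {W} {W} (λ _ _ → refl) (mulF-cong-Total≤ N oF oG G≈F p ∷ [])
        (order-mulF′ oF p ∷ []) (order-mulF′ oG p ∷ []) (N ∷ []) N≤N)))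
    (trans (*-cong (-1≈ pp char)
      (trans (∘ₛ-~ {A = Series.mulF (polyRing (Var i N)) F̂′ p} (mulF-~ {F̂′} {G′} (λ α → refl) p)
               ((λ α → refl) ∷ []) (N ∷ []))
        (sym (∘ₛ-cong-Total≤ N (mulF-cong-Total≤ N oF′ oG′ G′≈F′ p) ((λ _ _ → refl) ∷ [])
          (oW ∷ []) (oW ∷ []) (N ∷ []) N≤N))))
      (-1*x≈-x _))
    where
    oG  = order-≈ oF G≈F
    oG′ = order-≈ oF′ G′≈F′
    N≤N : total (N ∷ []) ≤ N
    N≤N = ℕₚ.≤-reflexive (total₁ N)

  exchange : ∀ {a b x y} → b + x ≈ a + y → y - x ≈ b - a
  exchange {a} {b} {x} {y} eq = +-cancelˡ a _ _ (begin
    a + (y - x)    ≈⟨ +-assoc a y (- x) ⟨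
    a + y - x      ≈⟨ +-congʳ eq ⟨
    b + x - x      ≈⟨ +-assoc b x (- x) ⟩
    b + (x - x)    ≈⟨ +-congˡ (trans (-‿inverseʳ x) (sym (-‿inverseʳ a))) ⟩
    b + (a - a)    ≈⟨ +-assoc b a (- a) ⟨
    b + a - a      ≈⟨ +-congʳ (+-comm b a) ⟩
    a + b - a      ≈⟨ +-assoc a b (- a) ⟩
    a + (b - a)    ∎)

  eval-Ĉ-equation : ∀ {p h} → Prime p → natR p ≈ 0# → 0 < i → N ≡ p ^ h ℕ.* i →
    (fgl : IsFGL F) (fgl′ : IsFGL F′) (hom : IsHom F F′ U) →
    VanishesOff (p ^ h) (mulF F p) → VanishesOff (p ^ h) (mulF F′ p) →
    (coeff₁ (mulF F′ p) (p ^ h) * (coeff₁ U i ^ᴿ (p ^ h))) - ((coeff₁ (mulF F p) (p ^ h) ^ᴿ i) * coeff₁ U i)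
      ≈ eval ρ (Ĉ p)
  eval-Ĉ-equation {p} {h} pp char 0<i N≡qi fgl fgl′ hom vanish vanish′ = trans
    (exchange (begin
      coeff₁ (W ∘ₛ (P ∷ [])) N + (coeff₁ P q ^ᴿ i) * coeff₁ U i
        ≈⟨ at-N (λ M → coeff₁ (U ∘ₛ (P ∷ [])) M ≈ coeff₁ (W ∘ₛ (P ∷ [])) M + (coeff₁ P q ^ᴿ i) * coeff₁ U i)
             (∘ₛ-truncated oU oW W≈U Wᵢ≈0 (ℕ.>-nonZero⁻¹ q) (order≥q (order-mulF F fgl p) vanish)) ⟨
      coeff₁ (U ∘ₛ (P ∷ [])) N
        ≈⟨ hom-mulF F F′ fgl fgl′ U hom (ℕ.>-nonZero⁻¹ p) (N ∷ []) ⟩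
      coeff₁ (P′ ∘ₛ (U ∷ [])) N
        ≈⟨ at-N (λ M → coeff₁ (P′ ∘ₛ (U ∷ [])) M ≈ coeff₁ (P′ ∘ₛ (W ∷ [])) M + coeff₁ P′ q * (coeff₁ U i ^ᴿ q))
             (truncated-∘ₛ oU oW W≈U Wᵢ≈0 {h = h} {P′} char pp 0<i vanish′) ⟩
      coeff₁ (P′ ∘ₛ (W ∷ [])) N + coeff₁ P′ q * (coeff₁ U i ^ᴿ q) ∎))
    (sym (eval-Ĉ pp char (order-F F fgl) (order-F F′ fgl′) oW))
    where
    q = p ^ h
    P P′ : PS 1
    P  = mulF F p
    P′ = mulF F′ p
    instance
      p≢0 = prime⇒nonZero pp
      q≢0 = ℕₚ.m^n≢0 p h

    at-N : (T : ℕ → Set ℓ) → T (q ℕ.* i) → T N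
    at-N T = ≡.subst T (≡.sym N≡qi)

    oU = order-U F F′ fgl fgl′ U hom

    oW : Order≥ 1 W
    oW (0 ∷ [])     _        = trans (W≈U 0 0<i) (proj₁ hom)
    oW (suc _ ∷ []) (s≤s ())

theorem7p2 : (p : ℕ) → Prime p → (h : ℕ) → 0 < h → (e : ℕ) →
    ∃ω (Poly (Var (p ^ e) ((p ^ h) ℕ.* (p ^ e)))) λ C →
      ∀ {c ℓ} (R : CommutativeRing c ℓ) →
      let open CommutativeRing R
          open Series R
          q = p ^ h
          i = p ^ e
      in IsIntegralDomain → HasCharacteristic p →
         (F F′ : PS 2) → IsFGL F → IsFGL F′ →
         HeightFGL p F h → HeightFGL p F′ h →
         (U : PS 1) → IsHom F F′ U →
         (n n′ : ℕ) → FirstNonzero (mulF F p) n → FirstNonzero (mulF F′ p) n′ →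
         let v₁  = coeff₁ (mulF F p) n
             v₁′ = coeff₁ (mulF F′ p) n′
             uᵢ  = coeff₁ U i
         in (v₁′ * (uᵢ ^ᴿ q)) - ((v₁ ^ᴿ i) * uᵢ) ≈ eval (valuation U F F′) C
theorem7p2 p pp h _ e = Universal.Ĉ i N p ,ω
  λ R domain char F F′ fgl fgl′ height height′ U hom n n′ first first′ →
    conclude R domain char F F′ fgl fgl′ height height′ U hom
      (Height.firstNonzero≡q R F fgl pp char domain height first)
      (Height.firstNonzero≡q R F′ fgl′ pp char domain height′ first′)
  where
  q i N : ℕ
  q = p ^ h
  i = p ^ e
  N = q ℕ.* i

  -- The indices of the first nonzero coefficients are abstracted so that matching on the two
  -- equations replaces them by q.
  conclude : ∀ {c ℓ} (R : CommutativeRing c ℓ) →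
    let open CommutativeRing R
        open Series R
    in IsIntegralDomain → HasCharacteristic p →
       (F F′ : PS 2) → IsFGL F → IsFGL F′ → HeightFGL p F h → HeightFGL p F′ h →
       (U : PS 1) → IsHom F F′ U → ∀ {n n′} → n ≡ q → n′ ≡ q →
       (coeff₁ (mulF F′ p) n′ * (coeff₁ U i ^ᴿ q)) - ((coeff₁ (mulF F p) n ^ᴿ i) * coeff₁ U i)
         ≈ eval (valuation U F F′) (Universal.Ĉ i N p)
  conclude R domain char F F′ fgl fgl′ (factors , _) (factors′ , _) U hom ≡.refl ≡.refl =
    Specialisation.eval-Ĉ-equation R i N U F F′ {p} {h} pp char
      (ℕ.>-nonZero⁻¹ i {{ℕₚ.m^n≢0 p e {{prime⇒nonZero pp}}}}) ≡.refl fgl fgl′ hom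
      (Height.factors⇒vanishes R p h factors) (Height.factors⇒vanishes R p h factors′)
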